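{- The path $P_7$ is $2$-good.
   Context: All graphs are finite and simple; $P_7$ is the path on $7$ vertices. $R_2(H)$ is the smallest integer $N$ such that every $2$-coloring of the edges of $K_N$ contains a monochromatic copy of $H$. $H$ is $2$-good if for every graph $G$ with chromatic number $R_2(H)$ and every $2$-coloring of the edges of $G$, there is a monochromatic copy of $H$. -}

module Defs where

open import Data.Nat using (ℕ; suc; _≤_; _≡ᵇ_)
open import Data.Fin using (Fin; _≟_; toℕ)
open import Data.Bool using (Bool; true; false; not; _∨_)
open import Data.Product using (Σ; _×_; ∃)
open import Relation.Nullary using (¬_)
open import Relation.Nullary.Decidable using (⌊_⌋)
open import Relation.Binary.PropositionalEquality using (_≡_; _≢_)
open import Function.Definitions using (Injective)

Adj : ℕ → Set
Adj n = Fin n → Fin n → Bool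

record Graph (n : ℕ) : Set where
  field
    adj    : Adj n
    sym    : ∀ u v → adj u v ≡ adj v u
    irrefl : ∀ v → adj v v ≡ false
open Graph public

adjK : (N : ℕ) → Adj N
adjK N i j = not ⌊ i ≟ j ⌋

adjP : (m : ℕ) → Adj m
adjP m i j = (toℕ j ≡ᵇ suc (toℕ i)) ∨ (toℕ i ≡ᵇ suc (toℕ j))

record EdgeColouring {n : ℕ} (a : Adj n) : Set where
  field
    colour : Fin n → Fin n → Fin 2
    colour-sym : ∀ u v → a u v ≡ true → colour u v ≡ colour v u
open EdgeColouring public

MonoCopy : {m n : ℕ} (h : Adj m) (a : Adj n) → EdgeColouring a → Set
MonoCopy {m} {n} h a c =
  Σ (Fin 2) λ k → Σ (Fin m → Fin n) λ f →
    Injective _≡_ _≡_ f ×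
    (∀ i j → h i j ≡ true → (a (f i) (f j) ≡ true × colour c (f i) (f j) ≡ k))

Arrows2 : {m : ℕ} → Adj m → ℕ → Set
Arrows2 h N = (c : EdgeColouring (adjK N)) → MonoCopy h (adjK N) c

IsR2 : {m : ℕ} → Adj m → ℕ → Set
IsR2 h N = Arrows2 h N × (∀ M → Arrows2 h M → N ≤ M)

Colourable : {n : ℕ} → Graph n → ℕ → Set
Colourable {n} G k =
  Σ (Fin n → Fin k) λ col → ∀ u v → adj G u v ≡ true → col u ≢ col v

HasChromaticNumber : {n : ℕ} → Graph n → ℕ → Set
HasChromaticNumber G χ = Colourable G χ × (∀ k → Colourable G k → χ ≤ k)

TwoGood : {m : ℕ} → Adj m → Set
TwoGood h = ∀ N → IsR2 h N → ∀ (n : ℕ) (G : Graph n) → HasChromaticNumber G N →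
  (c : EdgeColouring (adj G)) → MonoCopy h (adj G) c

{-# OPTIONS --safe #-}

-- A graph is split by its colouring into two P₇-free graphs A and B; we show
-- that A ∪ B is then 8-colourable, whereas R₂(P₇) ≥ 9.  A vertex v with
-- deg A v + deg B v ≤ 7 can be deleted and coloured last, so suppose there is
-- none.  Call a vertex low if its degree is at most 2 and high if it is at
-- least 6: low in A implies high in B, and low in B high in A.  A discharging argument
-- shows that a P₇-free graph with a high vertex has more low vertices than
-- high ones, so going round A, B, A gives a contradiction unless neither graph
-- has high vertices, hence neither has low ones.  By Pósa's crossing argument a
-- component of a P₇-free graph with minimum degree 3 has at most 6 vertices.
-- Regard each vertex as an edge joining its A-component to its B-component:
-- this is a bipartite multigraph of maximum degree at most 6, and König's edge
-- colouring theorem colours it properly, which is a proper colouring of A ∪ B.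
module Submission where

open import Defs hiding (sym)
open import Data.Bool using (Bool; true; false; _∧_; _∨_; if_then_else_; T)
import Data.Bool as Bool
import Data.Bool.Properties as Bool
open import Data.Empty using (⊥; ⊥-elim)
open import Data.Fin using (Fin; zero; suc; toℕ; punchIn; punchOut; _≟_)
open import Data.Fin.Patterns
open import Data.Fin.Properties using (any?; all?; punchIn-injective; punchInᵢ≢i; punchIn-punchOut; toℕ<n; toℕ-injective)
open import Data.List using (List; []; _∷_; [_]; _++_; length; map; filter; lookup; allFin; upTo)
open import Data.List.Membership.Propositional using (_∈_; _∉_)
open import Data.List.Membership.Propositional.Properties using (∈-lookup; ∈-map⁺; ∈-map⁻; ∈-++⁺ˡ; ∈-++⁺ʳ; ∈-++⁻; ∈-∃++; ∈-filter⁺; ∈-filter⁻; ∈-allFin; ∈-upTo⁺)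
open import Data.List.Properties using (length-map; length-++; length-tabulate; ++-assoc)
open import Data.List.Relation.Binary.Permutation.Propositional using (_↭_; ↭-sym; ↭⇒↭ₛ)
open import Data.List.Relation.Binary.Permutation.Propositional.Properties using (∈-resp-↭; ↭-length; ++-comm)
import Data.List.Relation.Binary.Permutation.Setoid.Properties as Permutation
open import Data.List.Relation.Binary.Subset.Propositional using (_⊆_)
open import Data.List.Relation.Unary.All as All using (All; []; _∷_)
open import Data.List.Relation.Unary.All.Properties using (¬Any⇒All¬)
open import Data.List.Relation.Unary.AllPairs using ([]; _∷_)
open import Data.List.Relation.Unary.Any using (here; there)
open import Data.List.Relation.Unary.Linked as Linked using (Linked; []; [-]; _∷_)
import Data.List.Relation.Unary.Linked.Properties as Linked
import Data.List.Relation.Unary.Unique.DecPropositional as DecUnique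
open import Data.List.Relation.Unary.Unique.Propositional using (Unique)
import Data.List.Relation.Unary.Unique.Propositional.Properties as Unique
open import Data.Nat as ℕ using (ℕ; zero; suc; _+_; _*_; _≤_; _<_; z≤n; s≤s; _≤?_; _≡ᵇ_; _<ᵇ_)
open import Data.Nat.ListAction using (sum)
open import Data.Nat.Properties as ℕ using (≤-refl; ≤-trans; ≤-reflexive; <-≤-trans; <⇒≱; ≰⇒>; +-suc; +-mono-≤; +-mono-<-≤; +-mono-≤-<; module ≤-Reasoning)
open import Data.Product using (∃; _×_; _,_; proj₁; proj₂)
open import Data.Sum using (_⊎_; inj₁; inj₂)
open import Data.Vec.Functional using (insertAt)
open import Data.Vec.Functional.Properties using (insertAt-lookup; insertAt-punchIn)
open import Function using (_∘_; id; const)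
open import Relation.Binary.Construct.Closure.ReflexiveTransitive as Star using (Star; ε; _◅_; _◅◅_)
open import Relation.Binary.PropositionalEquality using (_≡_; _≢_; refl; sym; trans; cong; cong₂; subst; setoid)
open import Relation.Nullary using (¬_; Dec; does; yes; no; contradiction)
open import Relation.Nullary.Decidable using (True; toWitness; dec-true; _×-dec_; _⊎-dec_; _→-dec_; ¬?; decidable-stable; map′)
open import Relation.Unary using (Decidable)
open import Algebra.Properties.CommutativeSemigroup ℕ.+-commutativeSemigroup using (x∙yz≈y∙xz)

-- Duplicate-free lists and the pigeonhole principle.

module _ {a} {A : Set a} where

  unique-∷ : ∀ {x : A} {xs} → x ∉ xs → Unique xs → Unique (x ∷ xs)
  unique-∷ x∉xs xs! = ¬Any⇒All¬ _ x∉xs ∷ xs!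

  ∈-∷⁻ : ∀ {x y : A} {xs} → x ∈ y ∷ xs → x ≢ y → x ∈ xs
  ∈-∷⁻ (here x≡y)  x≢y = contradiction x≡y x≢y
  ∈-∷⁻ (there x∈xs) _  = x∈xs

  unique-⊆⇒length-≤ : ∀ {xs ys : List A} → Unique xs → xs ⊆ ys → length xs ≤ length ys
  unique-⊆⇒length-≤ {[]} _ _ = z≤n
  unique-⊆⇒length-≤ {x ∷ xs} {ys} (x≢ ∷ xs!) xs⊆ys with ∈-∃++ (xs⊆ys (here refl))
  ... | ps , qs , refl = begin
    suc (length xs)          ≤⟨ s≤s (unique-⊆⇒length-≤ xs! xs⊆ps++qs) ⟩
    suc (length (ps ++ qs))  ≡⟨ length-insert ps ⟨
    length (ps ++ x ∷ qs)    ∎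
    where
    open ≤-Reasoning
    length-insert : ∀ ps {qs} → length (ps ++ x ∷ qs) ≡ suc (length (ps ++ qs))
    length-insert []       = refl
    length-insert (_ ∷ ps) = cong suc (length-insert ps)
    xs⊆ps++qs : xs ⊆ ps ++ qs
    xs⊆ps++qs y∈xs with ∈-++⁻ ps (xs⊆ys (there y∈xs))
    ... | inj₁ y∈ps           = ∈-++⁺ˡ y∈ps
    ... | inj₂ (here y≡x)     = contradiction (sym y≡x) (All.lookup x≢ y∈xs)
    ... | inj₂ (there y∈qs)   = ∈-++⁺ʳ ps y∈qs

  lookup-injective : ∀ {xs : List A} → Unique xs → ∀ {i j} → lookup xs i ≡ lookup xs j → i ≡ j
  lookup-injective {_ ∷ _} _        {zero}  {zero}  _  = refl
  lookup-injective {_ ∷ _} (x≢ ∷ _) {zero}  {suc j} eq = contradiction eq (All.lookup x≢ (∈-lookup j))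
  lookup-injective {_ ∷ _} (x≢ ∷ _) {suc i} {zero}  eq = contradiction (sym eq) (All.lookup x≢ (∈-lookup i))
  lookup-injective {_ ∷ _} (_ ∷ u)  {suc i} {suc j} eq = cong suc (lookup-injective u eq)

  -- New paths through the vertices of a known path are given by lists of positions on it.
  select : ∀ (xs : List A) → List (Fin (length xs)) → List A
  select xs = map (lookup xs)

  -- Distinctness of the chosen positions is decided by computation.
  select-unique : ∀ {xs : List A} → Unique xs → ∀ is {_ : True (DecUnique.unique? _≟_ is)} → Unique (select xs is)
  select-unique xs! is {is!} = Unique.map⁺ (lookup-injective xs!) (toWitness is!)

  select-⊆ : ∀ (xs : List A) is → select xs is ⊆ xs
  select-⊆ xs is y∈ with ∈-map⁻ (lookup xs) y∈
  ... | i , _ , refl = ∈-lookup i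

module _ {n : ℕ} where

  open import Data.List.Membership.DecPropositional (_≟_ {n}) using (_∈?_) public

  ⊆-or-∉ : ∀ (xs ys : List (Fin n)) → xs ⊆ ys ⊎ ∃ λ x → x ∈ xs × x ∉ ys
  ⊆-or-∉ xs ys with any? (λ x → x ∈? xs ×-dec ¬? (x ∈? ys))
  ... | yes p = inj₂ p
  ... | no ¬p = inj₁ λ {x} x∈xs → decidable-stable (x ∈? ys) λ x∉ys → ¬p (x , x∈xs , x∉ys)

  longer⇒∃∉ : ∀ {xs ys : List (Fin n)} → Unique xs → length ys < length xs → ∃ λ x → x ∈ xs × x ∉ ys
  longer⇒∃∉ {xs} {ys} xs! ys<xs with ⊆-or-∉ xs ys
  ... | inj₁ xs⊆ys = contradiction (unique-⊆⇒length-≤ xs! xs⊆ys) (<⇒≱ ys<xs)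
  ... | inj₂ p     = p

  ⊆-length⇒⊇ : ∀ {xs ys : List (Fin n)} → Unique ys → ys ⊆ xs → length xs ≤ length ys → xs ⊆ ys
  ⊆-length⇒⊇ {xs} {ys} ys! ys⊆xs xs≤ys {z} z∈xs = decidable-stable (z ∈? ys) λ z∉ys →
    <⇒≱ (unique-⊆⇒length-≤ (unique-∷ z∉ys ys!) λ { (here refl) → z∈xs ; (there y∈) → ys⊆xs y∈ }) xs≤ys

  unique⇒length-≤ : ∀ {xs : List (Fin n)} → Unique xs → length xs ≤ n
  unique⇒length-≤ xs! = ≤-trans (unique-⊆⇒length-≤ xs! λ _ → ∈-allFin _) (≤-reflexive (length-tabulate {n = n} id))

-- Sums and double counting

module _ {a} {A : Set a} where

  sum-map-≤ : ∀ {f g : A → ℕ} xs → (∀ {x} → x ∈ xs → f x ≤ g x) → sum (map f xs) ≤ sum (map g xs)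
  sum-map-≤ []       _   = z≤n
  sum-map-≤ (x ∷ xs) f≤g = +-mono-≤ (f≤g (here refl)) (sum-map-≤ xs (f≤g ∘ there))

  sum-map-< : ∀ {f g : A → ℕ} {xs z} → (∀ {x} → x ∈ xs → f x ≤ g x) → z ∈ xs → f z < g z →
              sum (map f xs) < sum (map g xs)
  sum-map-< {xs = x ∷ xs} f≤g (here refl)  fz<gz = +-mono-<-≤ fz<gz (sum-map-≤ xs (f≤g ∘ there))
  sum-map-< {xs = x ∷ xs} f≤g (there z∈xs) fz<gz = +-mono-≤-< (f≤g (here refl)) (sum-map-< (f≤g ∘ there) z∈xs fz<gz)

  sum-map-const : ∀ k (xs : List A) → sum (map (const k) xs) ≡ length xs * k
  sum-map-const k []       = refl
  sum-map-const k (_ ∷ xs) = cong (k +_) (sum-map-const k xs)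

module _ {a b r} {A : Set a} {B : Set b} {R : A → B → Set r} (R? : ∀ x y → Dec (R x y)) where

  double-count : ∀ xs ys → sum (map (λ x → length (filter (R? x) ys)) xs)
                         ≡ sum (map (λ y → length (filter (λ x → R? x y) xs)) ys)
  double-count []       ys = sym (trans (sum-map-const 0 ys) (ℕ.*-zeroʳ (length ys)))
  double-count (x ∷ xs) ys = trans (cong (length (filter (R? x) ys) +_) (double-count xs ys)) (add-row ys)
    where
    add-row : ∀ ys → length (filter (R? x) ys) + sum (map (λ y → length (filter (λ x → R? x y) xs)) ys)
                   ≡ sum (map (λ y → length (filter (λ x → R? x y) (x ∷ xs))) ys)
    add-row []       = refl
    add-row (y ∷ ys) with R? x y
    ... | yes _ = cong suc (trans (x∙yz≈y∙xz (length (filter (R? x) ys)) (length (filter (λ x → R? x y) xs)) _)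
                                  (cong (length (filter (λ x → R? x y) xs) +_) (add-row ys)))
    ... | no  _ = trans (x∙yz≈y∙xz (length (filter (R? x) ys)) (length (filter (λ x → R? x y) xs)) _)
                        (cong (length (filter (λ x → R? x y) xs) +_) (add-row ys))

-- Degrees

module Degrees {n : ℕ} (F : Graph n) where

  infix 4 _~_ _~?_

  _~_ : Fin n → Fin n → Set
  u ~ v = adj F u v ≡ true

  _~?_ : ∀ u v → Dec (u ~ v)
  u ~? v = adj F u v Bool.≟ true

  ~-sym : ∀ {u v} → u ~ v → v ~ u
  ~-sym {u} {v} = trans (Graph.sym F v u)

  ~⇒≢ : ∀ {u v} → u ~ v → u ≢ v
  ~⇒≢ {u} u~u refl with () ← trans (sym u~u) (irrefl F u)

  nbrs : Fin n → List (Fin n)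
  nbrs v = filter (v ~?_) (allFin n)

  deg : Fin n → ℕ
  deg v = length (nbrs v)

  ∈-nbrs⁺ : ∀ {v w} → v ~ w → w ∈ nbrs v
  ∈-nbrs⁺ {v} = ∈-filter⁺ (v ~?_) (∈-allFin _)

  ∈-nbrs⁻ : ∀ {v w} → w ∈ nbrs v → v ~ w
  ∈-nbrs⁻ {v} = proj₂ ∘ ∈-filter⁻ (v ~?_) {xs = allFin n}

  nbrs-unique : ∀ v → Unique (nbrs v)
  nbrs-unique v = Unique.filter⁺ (v ~?_) (Unique.allFin⁺ n)

  nbr-outside : ∀ {v} ys → length ys < deg v → ∃ λ w → v ~ w × w ∉ ys
  nbr-outside {v} ys ys<deg with longer⇒∃∉ (nbrs-unique v) ys<deg
  ... | w , w∈ , w∉ys = w , ∈-nbrs⁻ w∈ , w∉ys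

  deg-≤ : ∀ {v} ys → (∀ {w} → v ~ w → w ∈ ys) → deg v ≤ length ys
  deg-≤ {v} ys h = unique-⊆⇒length-≤ (nbrs-unique v) (h ∘ ∈-nbrs⁻)

  deg≤1⇒≡ : ∀ {v x y} → deg v ≤ 1 → v ~ x → v ~ y → x ≡ y
  deg≤1⇒≡ {v} {x} {y} deg≤1 v~x v~y = decidable-stable (x ≟ y) λ x≢y →
    <⇒≱ (unique-⊆⇒length-≤ {xs = x ∷ y ∷ []} ((x≢y ∷ []) ∷ [] ∷ [])
          λ { (here refl) → ∈-nbrs⁺ v~x ; (there (here refl)) → ∈-nbrs⁺ v~y })
        deg≤1

  P₇-free : Set
  P₇-free = ∀ xs → length xs ≡ 7 → Unique xs → Linked _~_ xs → ⊥

  Low High : Fin n → Set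
  Low x  = deg x ≤ 2
  High v = 6 ≤ deg v

  low? : Decidable Low
  low? x = deg x ≤? 2

  high? : Decidable High
  high? v = 6 ≤? deg v

  lows highs : List (Fin n)
  lows  = filter low? (allFin n)
  highs = filter high? (allFin n)

  ∈-lows⁺ : ∀ {x} → Low x → x ∈ lows
  ∈-lows⁺ = ∈-filter⁺ low? (∈-allFin _)

  ∈-lows⁻ : ∀ {x} → x ∈ lows → Low x
  ∈-lows⁻ = proj₂ ∘ ∈-filter⁻ low? {xs = allFin n}

  ∈-highs⁺ : ∀ {x} → High x → x ∈ highs
  ∈-highs⁺ = ∈-filter⁺ high? (∈-allFin _)

  ∈-highs⁻ : ∀ {x} → x ∈ highs → High x
  ∈-highs⁻ = proj₂ ∘ ∈-filter⁻ high? {xs = allFin n}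

  lows-unique : Unique lows
  lows-unique = Unique.filter⁺ low? (Unique.allFin⁺ n)

  highs-unique : Unique highs
  highs-unique = Unique.filter⁺ high? (Unique.allFin⁺ n)

  -- The charging scheme: a low vertex x pays its neighbours, and a leaf x
  -- hanging on u also pays v if u is a star centre whose only neighbour
  -- that is not a leaf is v.
  Pays : Fin n → Fin n → Set
  Pays x v = x ~ v ⊎ ∃ λ u → deg x ≤ 1 × x ~ u × u ~ v × (∀ w → u ~ w → w ≡ v ⊎ deg w ≤ 1)

  abstract
    pays? : ∀ x v → Dec (Pays x v)
    pays? x v = x ~? v ⊎-dec any? λ u → deg x ≤? 1 ×-dec x ~? u ×-dec u ~? v ×-dec
                  all? λ w → u ~? w →-dec (w ≟ v ⊎-dec deg w ≤? 1)

  payers payees : Fin n → List (Fin n)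
  payers v = filter (λ x → pays? x v) lows
  payees x = filter (pays? x) highs

  payers-≥ : ∀ {v xs} → Unique xs → All (λ x → Low x × Pays x v) xs → length xs ≤ length (payers v)
  payers-≥ {v} xs! ps = unique-⊆⇒length-≤ xs! λ x∈ → let low , pays = All.lookup ps x∈ in
    ∈-filter⁺ (λ x → pays? x v) (∈-lows⁺ low) pays

  private
    -- Of three elements two share a property and therefore coincide.
    two-values : ∀ {P Q : Fin n → Set} → (∀ {x y} → P x → P y → x ≡ y) → (∀ {x y} → Q x → Q y → x ≡ y) →
                 ∀ {xs} → Unique xs → All (λ x → P x ⊎ Q x) xs → length xs ≤ 2
    two-values p q {[]}             _ _ = z≤n
    two-values p q {_ ∷ []}         _ _ = s≤s z≤n
    two-values p q {_ ∷ _ ∷ []}     _ _ = s≤s (s≤s z≤n)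
    two-values p q {_ ∷ _ ∷ _ ∷ _} ((x≢y ∷ x≢z ∷ _) ∷ (y≢z ∷ _) ∷ _) (x ∷ y ∷ z ∷ _) = ⊥-elim (clash x y z)
      where
      clash : _ ⊎ _ → _ ⊎ _ → _ ⊎ _ → ⊥
      clash (inj₁ x) (inj₁ y) _        = x≢y (p x y)
      clash (inj₁ x) (inj₂ _) (inj₁ z) = x≢z (p x z)
      clash (inj₁ _) (inj₂ y) (inj₂ z) = y≢z (q y z)
      clash (inj₂ x) (inj₂ y) _        = x≢y (q x y)
      clash (inj₂ x) (inj₁ _) (inj₂ z) = x≢z (q x z)
      clash (inj₂ _) (inj₁ y) (inj₁ z) = y≢z (p y z)

  ∈-payees⁻ : ∀ {x v} → v ∈ payees x → High v × Pays x v
  ∈-payees⁻ {x} v∈ = let v∈highs , pays = ∈-filter⁻ (pays? x) v∈ in ∈-highs⁻ v∈highs , pays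

  payees-unique : ∀ x → Unique (payees x)
  payees-unique x = Unique.filter⁺ (pays? x) highs-unique

  -- A vertex of degree two pays only its neighbours. A leaf pays its only neighbour `u` and at most
  -- one vertex beyond: if `v` and `w` were both paid through `u`, then `w` would be `v` or a leaf,
  -- and a high vertex is no leaf.
  payees-≤2 : ∀ {x} → Low x → length (payees x) ≤ 2
  payees-≤2 {x} low with deg x ≤? 1
  ... | no deg≰1 = ≤-trans (unique-⊆⇒length-≤ (payees-unique x) (nbr ∘ ∈-payees⁻)) low
    where
    nbr : ∀ {v} → High v × Pays x v → v ∈ nbrs x
    nbr (_ , inj₁ x~v)             = ∈-nbrs⁺ x~v
    nbr (_ , inj₂ (_ , deg≤1 , _)) = contradiction deg≤1 deg≰1
  ... | yes deg≤1 = two-values (deg≤1⇒≡ deg≤1) far-unique (payees-unique x) (All.tabulate (split ∘ ∈-payees⁻))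
    where
    Far : Fin n → Set
    Far v = High v × ∃ λ u → x ~ u × u ~ v × (∀ w → u ~ w → w ≡ v ⊎ deg w ≤ 1)
    split : ∀ {v} → High v × Pays x v → x ~ v ⊎ Far v
    split (_ , inj₁ x~v)             = inj₁ x~v
    split (high , inj₂ (u , _ , p)) = inj₂ (high , u , p)
    far-unique : ∀ {v w} → Far v → Far w → v ≡ w
    far-unique (_ , u , x~u , u~v , only) (high , u′ , x~u′ , u′~w , _)
      with refl ← deg≤1⇒≡ deg≤1 x~u x~u′ | only _ u′~w
    ... | inj₁ w≡v   = sym w≡v
    ... | inj₂ deg≤1 = contradiction (≤-trans high deg≤1) λ { (s≤s ()) }

-- Payments received by a high vertex.

module HighVertex {n : ℕ} (F : Graph n) (free : Degrees.P₇-free F) {v : Fin n} (high : Degrees.High F v) where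

  open Degrees F

  nbr-of-high : ∀ ys → {True (length ys ≤? 5)} → ∃ λ y → v ~ y × y ∉ ys
  nbr-of-high ys {l} = nbr-outside ys (≤-trans (s≤s (toWitness l)) high)

  -- One of the six neighbours of `v` is off the five given vertices and can be put in front of `v`,
  -- making a path on seven vertices.
  no-P₅ : ∀ {p q r s t} → Unique (v ∷ p ∷ q ∷ r ∷ s ∷ t ∷ []) → v ~ p → ¬ Linked _~_ (p ∷ q ∷ r ∷ s ∷ t ∷ [])
  no-P₅ {p} {q} {r} {s} {t} u! v~p path with nbr-of-high (p ∷ q ∷ r ∷ s ∷ t ∷ [])
  ... | y , v~y , y∉ = free (y ∷ v ∷ p ∷ q ∷ r ∷ s ∷ t ∷ []) refl
    (unique-∷ (λ { (here y≡v) → ~⇒≢ v~y (sym y≡v) ; (there y∈) → y∉ y∈ }) u!) (~-sym v~y ∷ v~p ∷ path)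

  -- The number counts the vertices after `v`. By `no-P₅` a path leaving `v` has at most four of
  -- them, and the argument splits into the cases four, three and at most two.
  P₃-from-nbr P₄-from-nbr : Set
  P₃-from-nbr = ∃ λ c → ∃ λ a → ∃ λ b → Unique (v ∷ c ∷ a ∷ b ∷ []) × Linked _~_ (v ∷ c ∷ a ∷ b ∷ [])
  P₄-from-nbr = ∃ λ c → ∃ λ a → ∃ λ b → ∃ λ d → Unique (v ∷ c ∷ a ∷ b ∷ d ∷ []) × Linked _~_ (v ∷ c ∷ a ∷ b ∷ d ∷ [])

  P₃-from-nbr? : Dec P₃-from-nbr
  P₃-from-nbr? = any? λ c → any? λ a → any? λ b →
    DecUnique.unique? _≟_ (v ∷ c ∷ a ∷ b ∷ []) ×-dec Linked.linked? _~?_ (v ∷ c ∷ a ∷ b ∷ [])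

  P₄-from-nbr? : Dec P₄-from-nbr
  P₄-from-nbr? = any? λ c → any? λ a → any? λ b → any? λ d →
    DecUnique.unique? _≟_ (v ∷ c ∷ a ∷ b ∷ d ∷ []) ×-dec Linked.linked? _~?_ (v ∷ c ∷ a ∷ b ∷ d ∷ [])

  -- On average a high vertex should receive two payments, and a low one makes at most two. Each
  -- alternative makes the final count strict: a surplus at `v`, or a low vertex somewhere that pays
  -- at most once.
  WellPaid : Set
  WellPaid = 3 ≤ length (payers v) ⊎ (2 ≤ length (payers v) × ∃ λ x → Low x × length (payees x) ≤ 1)

  pays-nbr : ∀ {x} → Low x → v ~ x → Low x × Pays x v
  pays-nbr low v~x = low , inj₁ (~-sym v~x)

  module LongTail {c a b d : Fin n} (u! : Unique (v ∷ c ∷ a ∷ b ∷ d ∷ [])) (v~c : v ~ c) (c~a : c ~ a) (a~b : a ~ b) (b~d : b ~ d) where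

    module Outside {u : Fin n} (v~u : v ~ u) (u∉ : u ∉ c ∷ a ∷ b ∷ d ∷ []) where

      base : Unique (u ∷ v ∷ c ∷ a ∷ b ∷ d ∷ [])
      base = unique-∷ (λ { (here u≡v) → ~⇒≢ v~u (sym u≡v) ; (there u∈) → u∉ u∈ }) u!

      -- A neighbour off the path u, v, c, a, b, d prolongs it to seven vertices; adjacency of `u`
      -- to `c` or `d` gives a path with five vertices after `v`.
      nbrs-⊆ : ∀ {w} → u ~ w → w ∈ v ∷ a ∷ b ∷ []
      nbrs-⊆ {w} u~w with w ∈? (u ∷ v ∷ c ∷ a ∷ b ∷ d ∷ [])
      ... | no w∉ = ⊥-elim (free (w ∷ u ∷ v ∷ c ∷ a ∷ b ∷ d ∷ []) refl (unique-∷ w∉ base)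
                      (~-sym u~w ∷ ~-sym v~u ∷ v~c ∷ c~a ∷ a~b ∷ b~d ∷ [-]))
      ... | yes (here w≡u) = contradiction (sym w≡u) (~⇒≢ u~w)
      ... | yes (there (here refl)) = here refl
      ... | yes (there (there (here refl))) = ⊥-elim (no-P₅ (select-unique base (1F ∷ 0F ∷ 2F ∷ 3F ∷ 4F ∷ 5F ∷ [])) v~u
                      (u~w ∷ c~a ∷ a~b ∷ b~d ∷ [-]))
      ... | yes (there (there (there (here refl)))) = there (here refl)
      ... | yes (there (there (there (there (here refl))))) = there (there (here refl))
      ... | yes (there (there (there (there (there (here refl)))))) = ⊥-elim (no-P₅ (select-unique base (1F ∷ 2F ∷ 3F ∷ 4F ∷ 5F ∷ 0F ∷ [])) v~c
                      (c~a ∷ a~b ∷ b~d ∷ ~-sym u~w ∷ [-]))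

      -- Otherwise `u` could be inserted between `a` and `b`.
      not-both : u ~ a → ¬ u ~ b
      not-both u~a u~b = no-P₅ (select-unique base (1F ∷ 2F ∷ 3F ∷ 0F ∷ 4F ∷ 5F ∷ [])) v~c (c~a ∷ ~-sym u~a ∷ u~b ∷ b~d ∷ [-])

      low : Low u
      low with u ~? a
      ... | yes u~a = deg-≤ (v ∷ a ∷ []) λ u~w → case-w (nbrs-⊆ u~w) u~w
        where
        case-w : ∀ {w} → w ∈ v ∷ a ∷ b ∷ [] → u ~ w → w ∈ v ∷ a ∷ []
        case-w (here p)                   _   = here p
        case-w (there (here p))           _   = there (here p)
        case-w (there (there (here refl))) u~b = contradiction u~b (not-both u~a)
      ... | no u≁a = deg-≤ (v ∷ b ∷ []) λ u~w → case-w (nbrs-⊆ u~w) u~w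
        where
        case-w : ∀ {w} → w ∈ v ∷ a ∷ b ∷ [] → u ~ w → w ∈ v ∷ b ∷ []
        case-w (here p)             _   = here p
        case-w (there (here refl))  u~a = contradiction u~a u≁a
        case-w (there (there p))    _   = there p

      pays : Low u × Pays u v
      pays = pays-nbr low v~u

      -- v and a are then the two hubs of a subgraph of the kind K₂ + independent set.
      c-low : u ~ a → Low c
      c-low u~a = deg-≤ (v ∷ a ∷ []) nbrs-of-c
        where
        nbrs-of-c : ∀ {w} → c ~ w → w ∈ v ∷ a ∷ []
        nbrs-of-c {w} c~w with w ∈? (u ∷ v ∷ c ∷ a ∷ b ∷ d ∷ [])
        ... | no w∉ = ⊥-elim (free (w ∷ c ∷ v ∷ u ∷ a ∷ b ∷ d ∷ []) refl
                        (select-unique (unique-∷ w∉ base) (0F ∷ 3F ∷ 2F ∷ 1F ∷ 4F ∷ 5F ∷ 6F ∷ []))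
                        (~-sym c~w ∷ ~-sym v~c ∷ v~u ∷ u~a ∷ a~b ∷ b~d ∷ [-]))
        ... | yes (here refl) = ⊥-elim (no-P₅ (select-unique base (1F ∷ 0F ∷ 2F ∷ 3F ∷ 4F ∷ 5F ∷ [])) v~u
                        (~-sym c~w ∷ c~a ∷ a~b ∷ b~d ∷ [-]))
        ... | yes (there (here refl)) = here refl
        ... | yes (there (there (here w≡c))) = contradiction (sym w≡c) (~⇒≢ c~w)
        ... | yes (there (there (there (here refl)))) = there (here refl)
        ... | yes (there (there (there (there (here refl))))) = ⊥-elim (no-P₅ (select-unique base (1F ∷ 0F ∷ 3F ∷ 2F ∷ 4F ∷ 5F ∷ [])) v~u
                        (u~a ∷ ~-sym c~a ∷ c~w ∷ b~d ∷ [-]))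
        ... | yes (there (there (there (there (there (here refl)))))) = ⊥-elim (no-P₅ (select-unique base (1F ∷ 0F ∷ 3F ∷ 2F ∷ 5F ∷ 4F ∷ [])) v~u
                        (u~a ∷ ~-sym c~a ∷ c~w ∷ ~-sym b~d ∷ [-]))

      -- The edge from `u` to `b` makes d, b, u, v, c, a a path, which a new neighbour of `d` would
      -- prolong; adjacency of `d` to `u`, `c` or `a` gives five vertices after `v`.
      d-low : u ~ b → Low d
      d-low u~b = deg-≤ (v ∷ b ∷ []) nbrs-of-d
        where
        nbrs-of-d : ∀ {w} → d ~ w → w ∈ v ∷ b ∷ []
        nbrs-of-d {w} d~w with w ∈? (u ∷ v ∷ c ∷ a ∷ b ∷ d ∷ [])
        ... | no w∉ = ⊥-elim (free (w ∷ d ∷ b ∷ u ∷ v ∷ c ∷ a ∷ []) refl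
                        (select-unique (unique-∷ w∉ base) (0F ∷ 6F ∷ 5F ∷ 1F ∷ 2F ∷ 3F ∷ 4F ∷ []))
                        (~-sym d~w ∷ ~-sym b~d ∷ ~-sym u~b ∷ ~-sym v~u ∷ v~c ∷ c~a ∷ [-]))
        ... | yes (here refl) = ⊥-elim (no-P₅ (select-unique base (1F ∷ 2F ∷ 3F ∷ 4F ∷ 5F ∷ 0F ∷ [])) v~c
                        (c~a ∷ a~b ∷ b~d ∷ d~w ∷ [-]))
        ... | yes (there (here refl)) = here refl
        ... | yes (there (there (here refl))) = ⊥-elim (no-P₅ (select-unique base (1F ∷ 0F ∷ 4F ∷ 5F ∷ 2F ∷ 3F ∷ [])) v~u
                        (u~b ∷ b~d ∷ d~w ∷ c~a ∷ [-]))
        ... | yes (there (there (there (here refl)))) = ⊥-elim (no-P₅ (select-unique base (1F ∷ 0F ∷ 4F ∷ 5F ∷ 3F ∷ 2F ∷ [])) v~u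
                        (u~b ∷ b~d ∷ d~w ∷ ~-sym c~a ∷ [-]))
        ... | yes (there (there (there (there (here refl))))) = there (here refl)
        ... | yes (there (there (there (there (there (here w≡d)))))) = contradiction (sym w≡d) (~⇒≢ d~w)

      -- The only neighbour of `u` is `v`, so a second payment would need `v` to be a star centre.
      -- But its neighbours `c` and `a` are adjacent to each other, so neither is a leaf, and they
      -- cannot both be the one exceptional neighbour.
      leaf-pays-once : v ~ a → ¬ u ~ a → ¬ u ~ b → length (payees u) ≤ 1
      leaf-pays-once v~a u≁a u≁b = unique-⊆⇒length-≤ {ys = v ∷ []} (payees-unique u) (only-v ∘ proj₂ ∘ ∈-payees⁻)
        where
        nbr-is-v : ∀ {w} → w ∈ v ∷ a ∷ b ∷ [] → u ~ w → w ≡ v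
        nbr-is-v (here w≡v)                  _   = w≡v
        nbr-is-v (there (here refl))         u~a = contradiction u~a u≁a
        nbr-is-v (there (there (here refl))) u~b = contradiction u~b u≁b
        only-v : ∀ {w} → Pays u w → w ∈ v ∷ []
        only-v (inj₁ u~w) = here (nbr-is-v (nbrs-⊆ u~w) u~w)
        only-v (inj₂ (x , _ , u~x , x~w , only)) with refl ← nbr-is-v (nbrs-⊆ u~x) u~x = ⊥-elim (clash (only c v~c) (only a v~a))
          where
          not-leaf : ∀ {x y} → v ~ x → x ~ y → y ≢ v → ¬ deg x ≤ 1
          not-leaf v~x x~y y≢v deg≤1 = y≢v (deg≤1⇒≡ deg≤1 x~y (~-sym v~x))
          clash : c ≡ _ ⊎ deg c ≤ 1 → a ≡ _ ⊎ deg a ≤ 1 → ⊥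
          clash (inj₂ leaf) _           = not-leaf v~c c~a (~⇒≢ v~a ∘ sym) leaf
          clash _           (inj₂ leaf) = not-leaf v~a (~-sym c~a) (~⇒≢ v~c ∘ sym) leaf
          clash (inj₁ refl) (inj₁ a≡c)  = ~⇒≢ c~a (sym a≡c)

    -- At most four of the six neighbours lie on the path, so `u` and `u′` off the path both pay. A
    -- third payer is `c`, `d` or a further neighbour off the path; the latter exists when `v`
    -- misses `a` or `d`. In the remaining case `u` is a leaf that pays only once.
    well-paid : WellPaid
    well-paid with nbr-of-high (c ∷ a ∷ b ∷ d ∷ [])
    ... | u , v~u , u∉ with nbr-of-high (u ∷ c ∷ a ∷ b ∷ d ∷ [])
    ... | u′ , v~u′ , u′∉ = by-cases (v ~? a) (v ~? d) (u ~? a) (u ~? b)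
      where
      module U  = Outside v~u u∉
      module U′ = Outside v~u′ (u′∉ ∘ there)

      two! : Unique (u ∷ u′ ∷ [])
      two! = ((λ u≡u′ → u′∉ (here (sym u≡u′))) ∷ []) ∷ [] ∷ []

      with-third : ∀ {x} → Low x → v ~ x → x ∉ u ∷ u′ ∷ [] → WellPaid
      with-third low v~x x∉ = inj₁ (payers-≥ (unique-∷ x∉ two!) (pays-nbr low v~x ∷ U.pays ∷ U′.pays ∷ []))

      on-path : ∀ {x} → x ∈ c ∷ a ∷ b ∷ d ∷ [] → x ∉ u ∷ u′ ∷ []
      on-path x∈ (here refl)         = u∉ x∈
      on-path x∈ (there (here refl)) = u′∉ (there x∈)

      third-outside : ∀ ps → {True (length ps ≤? 3)} → (∀ {x} → v ~ x → x ∈ c ∷ a ∷ b ∷ d ∷ [] → x ∈ ps) → WellPaid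
      third-outside ps {l} h with nbr-outside {v} (u ∷ u′ ∷ ps) (≤-trans (s≤s (s≤s (s≤s (toWitness l)))) high)
      ... | x , v~x , x∉ = with-third (Outside.low v~x (x∉ ∘ there ∘ there ∘ h v~x)) v~x
        λ { (here p) → x∉ (here p) ; (there (here p)) → x∉ (there (here p)) }

      by-cases : Dec (v ~ a) → Dec (v ~ d) → Dec (u ~ a) → Dec (u ~ b) → WellPaid
      by-cases _ _ (yes u~a) _ = with-third (U.c-low u~a) v~c (on-path (here refl))
      by-cases _ (yes v~d) _ (yes u~b) = with-third (U.d-low u~b) v~d (on-path (there (there (there (here refl)))))
      by-cases _ (no v≁d) _ (yes _) = third-outside (c ∷ a ∷ b ∷ []) λ where
        v~x (here p)                 → here p
        v~x (there (here p))         → there (here p)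
        v~x (there (there (here p))) → there (there (here p))
        v~x (there (there (there (here refl)))) → contradiction v~x v≁d
      by-cases (no v≁a) _ _ _ = third-outside (c ∷ b ∷ d ∷ []) λ where
        v~x (here p)            → here p
        v~x (there (here refl)) → contradiction v~x v≁a
        v~x (there (there p))   → there p
      by-cases (yes v~a) _ (no u≁a) (no u≁b) =
        inj₂ (payers-≥ two! (U.pays ∷ U′.pays ∷ []) , u , U.low , U.leaf-pays-once v~a u≁a u≁b)

  -- A payer of v that can be charged to the neighbour u of v; the last
  -- component keeps the payers charged to different neighbours distinct.
  PayerAt : Fin n → Set
  PayerAt u = ∃ λ x → (Low x × Pays x v) × (x ≡ u ⊎ (¬ v ~ x × deg x ≤ 1 × x ~ u))

  -- A payer adjacent to `v` is charged only to itself, and a leaf not adjacent to `v` only to its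
  -- single neighbour.
  payer-injective : ∀ {u w} → v ~ u → v ~ w → (p : PayerAt u) (q : PayerAt w) → proj₁ p ≡ proj₁ q → u ≡ w
  payer-injective v~u v~w (_ , _ , inj₁ refl) (_ , _ , inj₁ refl) refl = refl
  payer-injective v~u v~w (_ , _ , inj₁ refl) (_ , _ , inj₂ (v≁x , _)) refl = contradiction v~u v≁x
  payer-injective v~u v~w (_ , _ , inj₂ (v≁x , _)) (_ , _ , inj₁ refl) refl = contradiction v~w v≁x
  payer-injective v~u v~w (_ , _ , inj₂ (_ , deg≤1 , x~u)) (_ , _ , inj₂ (_ , _ , x~w)) refl = deg≤1⇒≡ deg≤1 x~u x~w

  -- Six neighbours with at most three exceptions leave three, and their payers are distinct.
  three-payers : ∀ ps → {True (length ps ≤? 3)} → (∀ {u} → v ~ u → u ∉ ps → PayerAt u) → WellPaid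
  three-payers ps {l} payer
    with nbr-outside {v} ps (≤-trans (s≤s (toWitness l)) (≤-trans (s≤s (s≤s (s≤s (s≤s z≤n)))) high))
  ... | u₁ , v~u₁ , u₁∉ with nbr-outside {v} (u₁ ∷ ps) (≤-trans (s≤s (s≤s (toWitness l))) (≤-trans (s≤s (s≤s (s≤s (s≤s (s≤s z≤n))))) high))
  ... | u₂ , v~u₂ , u₂∉ with nbr-outside {v} (u₂ ∷ u₁ ∷ ps) (≤-trans (s≤s (s≤s (s≤s (toWitness l)))) high)
  ... | u₃ , v~u₃ , u₃∉ = inj₁ (payers-≥ {xs = proj₁ p₃ ∷ proj₁ p₂ ∷ proj₁ p₁ ∷ []}
    (((u₃∉ ∘ here ∘ payer-injective v~u₃ v~u₂ p₃ p₂) ∷ (u₃∉ ∘ there ∘ here ∘ payer-injective v~u₃ v~u₁ p₃ p₁) ∷ []) ∷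
     ((u₂∉ ∘ here ∘ payer-injective v~u₂ v~u₁ p₂ p₁) ∷ []) ∷ [] ∷ [])
    (proj₁ (proj₂ p₃) ∷ proj₁ (proj₂ p₂) ∷ proj₁ (proj₂ p₁) ∷ []))
    where
    p₁ : PayerAt u₁
    p₁ = payer v~u₁ u₁∉
    p₂ : PayerAt u₂
    p₂ = payer v~u₂ (u₂∉ ∘ there)
    p₃ : PayerAt u₃
    p₃ = payer v~u₃ (u₃∉ ∘ there ∘ there)

  low⇒payer : ∀ {u} → v ~ u → Low u → PayerAt u
  low⇒payer v~u low = _ , pays-nbr low v~u , inj₁ refl

  -- If `u` is not low, it has at least two neighbours besides `v`. The second hypothesis keeps them
  -- away from `v`, and then the first makes them leaves, so `u` is a star centre and each of its
  -- leaves pays `v`.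
  star⇒payer : ∀ {u} → v ~ u →
               (∀ {w x} → u ~ w → w ≢ v → w ~ x → x ≢ u → x ≢ v → ⊥) →
               (∀ {w w′} → u ~ w → u ~ w′ → w ≢ v → w′ ≢ v → w ≢ w′ → ¬ v ~ w) →
               PayerAt u
  star⇒payer {u} v~u no-deeper no-triangle with low? u
  ... | yes low   = low⇒payer v~u low
  ... | no ¬low with nbr-outside {u} (v ∷ []) (≤-trans (s≤s (s≤s z≤n)) (≰⇒> ¬low))
  ... | w , u~w , w∉ = w , (≤-trans (leaf u~w w≢v) (s≤s z≤n) ,
      inj₂ (u , leaf u~w w≢v , ~-sym u~w , ~-sym v~u , only-v)) , inj₂ (far u~w w≢v , leaf u~w w≢v , ~-sym u~w)
    where
    w≢v : w ≢ v
    w≢v = w∉ ∘ here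
    far : ∀ {w} → u ~ w → w ≢ v → ¬ v ~ w
    far {w} u~w w≢v with nbr-outside {u} (v ∷ w ∷ []) (≰⇒> ¬low)
    ... | w′ , u~w′ , w′∉ = no-triangle u~w u~w′ w≢v (w′∉ ∘ here) (w′∉ ∘ there ∘ here ∘ sym)
    leaf : ∀ {w} → u ~ w → w ≢ v → deg w ≤ 1
    leaf {w} u~w w≢v = deg-≤ (u ∷ []) λ {x} w~x → here (decidable-stable (x ≟ u) λ x≢u →
      no-deeper u~w w≢v w~x x≢u λ { refl → far u~w w≢v (~-sym w~x) })
    only-v : ∀ w → u ~ w → w ≡ v ⊎ deg w ≤ 1
    only-v w u~w with w ≟ v
    ... | yes w≡v = inj₁ w≡v
    ... | no  w≢v = inj₂ (leaf u~w w≢v)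

  private
    quad : ∀ {p q r s : Fin n} → p ≢ q → p ≢ r → p ≢ s → q ≢ r → q ≢ s → r ≢ s → Unique (p ∷ q ∷ r ∷ s ∷ [])
    quad a b c d e f = (a ∷ b ∷ c ∷ []) ∷ (d ∷ e ∷ []) ∷ (f ∷ []) ∷ [] ∷ []

  -- A violation of either hypothesis of `star⇒payer` is a path with three vertices after `v`: u, w,
  -- x or w, u, w′.
  no-P₃⇒well-paid : ¬ P₃-from-nbr → WellPaid
  no-P₃⇒well-paid no-P₃ = three-payers [] λ {u} v~u _ → star⇒payer v~u
    (λ {w} {x} u~w w≢v w~x x≢u x≢v → no-P₃ (u , w , x ,
      quad (~⇒≢ v~u) (w≢v ∘ sym) (x≢v ∘ sym) (~⇒≢ u~w) (x≢u ∘ sym) (~⇒≢ w~x) , v~u ∷ u~w ∷ w~x ∷ [-]))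
    (λ {w} {w′} u~w u~w′ w≢v w′≢v w≢w′ v~w → no-P₃ (w , u , w′ ,
      quad (w≢v ∘ sym) (~⇒≢ v~u) (w′≢v ∘ sym) (~⇒≢ u~w ∘ sym) w≢w′ (~⇒≢ u~w′) , v~w ∷ ~-sym u~w ∷ u~w′ ∷ [-]))

  module ShortTail (no-P₄ : ¬ P₄-from-nbr) {c a b : Fin n} (u! : Unique (v ∷ c ∷ a ∷ b ∷ [])) (v~c : v ~ c) (c~a : c ~ a) (a~b : a ~ b) where

    -- If `u` is adjacent to `a`, any neighbour other than `v` and `a` gives four vertices after
    -- `v`, so `u` is low. If not, `star⇒payer` applies: a violation gives four vertices after `v`,
    -- or joins with v, c, a, b to a path on seven vertices.
    payer : ∀ {u} → v ~ u → u ∉ c ∷ a ∷ b ∷ [] → PayerAt u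
    payer {u} v~u u∉ = by-case (u ~? a)
      where
      base : Unique (u ∷ v ∷ c ∷ a ∷ b ∷ [])
      base = unique-∷ (λ { (here u≡v) → ~⇒≢ v~u (sym u≡v) ; (there u∈) → u∉ u∈ }) u!

      u≁c : ¬ u ~ c
      u≁c u~c = no-P₄ (_ , _ , _ , _ , select-unique base (1F ∷ 0F ∷ 2F ∷ 3F ∷ 4F ∷ []) , v~u ∷ u~c ∷ c~a ∷ a~b ∷ [-])

      u≁b : ¬ u ~ b
      u≁b u~b = no-P₄ (_ , _ , _ , _ , select-unique base (1F ∷ 2F ∷ 3F ∷ 4F ∷ 0F ∷ []) , v~c ∷ c~a ∷ a~b ∷ ~-sym u~b ∷ [-])

      by-case : Dec (u ~ a) → PayerAt u
      by-case (yes u~a) = low⇒payer v~u (deg-≤ (v ∷ a ∷ []) nbrs-of-u)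
        where
        nbrs-of-u : ∀ {w} → u ~ w → w ∈ v ∷ a ∷ []
        nbrs-of-u {w} u~w with w ∈? (u ∷ v ∷ c ∷ a ∷ b ∷ [])
        ... | no w∉ = ⊥-elim (no-P₄ (_ , _ , _ , _ , select-unique (unique-∷ w∉ base) (2F ∷ 3F ∷ 4F ∷ 1F ∷ 0F ∷ []) ,
                        v~c ∷ c~a ∷ ~-sym u~a ∷ u~w ∷ [-]))
        ... | yes (here w≡u) = contradiction (sym w≡u) (~⇒≢ u~w)
        ... | yes (there (here p)) = here p
        ... | yes (there (there (here refl))) = contradiction u~w u≁c
        ... | yes (there (there (there (here p)))) = there (here p)
        ... | yes (there (there (there (there (here refl))))) = contradiction u~w u≁b
      by-case (no u≁a) = star⇒payer v~u no-deeper no-triangle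
        where
        fresh : ∀ {w} → u ~ w → w ≢ v → w ∉ u ∷ v ∷ c ∷ a ∷ b ∷ []
        fresh u~w w≢v (here w≡u) = ~⇒≢ u~w (sym w≡u)
        fresh u~w w≢v (there (here w≡v)) = w≢v w≡v
        fresh u~w w≢v (there (there (here refl))) = u≁c u~w
        fresh u~w w≢v (there (there (there (here refl)))) = u≁a u~w
        fresh u~w w≢v (there (there (there (there (here refl))))) = u≁b u~w

        no-deeper : ∀ {w x} → u ~ w → w ≢ v → w ~ x → x ≢ u → x ≢ v → ⊥
        no-deeper {w} {x} u~w w≢v w~x x≢u x≢v with x ∈? (w ∷ u ∷ v ∷ c ∷ a ∷ b ∷ [])
        ... | no x∉ = free (x ∷ w ∷ u ∷ v ∷ c ∷ a ∷ b ∷ []) refl (unique-∷ x∉ (unique-∷ (fresh u~w w≢v) base))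
                        (~-sym w~x ∷ ~-sym u~w ∷ ~-sym v~u ∷ v~c ∷ c~a ∷ a~b ∷ [-])
        ... | yes (here x≡w) = ~⇒≢ w~x (sym x≡w)
        ... | yes (there (here x≡u)) = x≢u x≡u
        ... | yes (there (there (here x≡v))) = x≢v x≡v
        ... | yes (there (there (there (here refl)))) = no-P₄ (_ , _ , _ , _ ,
                        select-unique (unique-∷ (fresh u~w w≢v) base) (2F ∷ 1F ∷ 0F ∷ 3F ∷ 4F ∷ []) , v~u ∷ u~w ∷ w~x ∷ c~a ∷ [-])
        ... | yes (there (there (there (there (here refl))))) = no-P₄ (_ , _ , _ , _ ,
                        select-unique (unique-∷ (fresh u~w w≢v) base) (2F ∷ 1F ∷ 0F ∷ 4F ∷ 5F ∷ []) , v~u ∷ u~w ∷ w~x ∷ a~b ∷ [-])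
        ... | yes (there (there (there (there (there (here refl)))))) = no-P₄ (_ , _ , _ , _ ,
                        select-unique (unique-∷ (fresh u~w w≢v) base) (2F ∷ 1F ∷ 0F ∷ 5F ∷ 4F ∷ []) , v~u ∷ u~w ∷ w~x ∷ ~-sym a~b ∷ [-])

        no-triangle : ∀ {w w′} → u ~ w → u ~ w′ → w ≢ v → w′ ≢ v → w ≢ w′ → ¬ v ~ w
        no-triangle {w} {w′} u~w u~w′ w≢v w′≢v w≢w′ v~w = free (w′ ∷ u ∷ w ∷ v ∷ c ∷ a ∷ b ∷ []) refl
          (select-unique (unique-∷ {xs = w ∷ u ∷ v ∷ c ∷ a ∷ b ∷ []}
             (λ { (here w′≡w) → w≢w′ (sym w′≡w) ; (there w′∈) → fresh u~w′ w′≢v w′∈ }) (unique-∷ (fresh u~w w≢v) base))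
             (0F ∷ 2F ∷ 1F ∷ 3F ∷ 4F ∷ 5F ∷ 6F ∷ []))
          (~-sym u~w′ ∷ u~w ∷ ~-sym v~w ∷ v~c ∷ c~a ∷ a~b ∷ [-])

    well-paid : WellPaid
    well-paid = three-payers (c ∷ a ∷ b ∷ []) payer

  well-paid : WellPaid
  well-paid with P₄-from-nbr?
  ... | yes (_ , _ , _ , _ , u! , v~c ∷ c~a ∷ a~b ∷ b~d ∷ [-]) = LongTail.well-paid u! v~c c~a a~b b~d
  ... | no no-P₄ with P₃-from-nbr?
  ... | yes (_ , _ , _ , u! , v~c ∷ c~a ∷ a~b ∷ [-]) = ShortTail.well-paid no-P₄ u! v~c c~a a~b
  ... | no no-P₃ = no-P₃⇒well-paid no-P₃

-- The discharging count of high against low vertices.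

module _ {n : ℕ} (F : Graph n) (free : Degrees.P₇-free F) where

  open Degrees F

  private
    paid-twice : ∀ {v} → High v → 2 ≤ length (payers v)
    paid-twice high with HighVertex.well-paid F free high
    ... | inj₁ 3≤      = ≤-trans (s≤s (s≤s z≤n)) 3≤
    ... | inj₂ (2≤ , _) = 2≤

    2*highs≤ : length highs * 2 ≤ sum (map (length ∘ payers) highs)
    2*highs≤ = ≤-trans (≤-reflexive (sym (sum-map-const 2 highs))) (sum-map-≤ highs (paid-twice ∘ ∈-highs⁻))

    ≤2*lows : sum (map (length ∘ payees) lows) ≤ length lows * 2
    ≤2*lows = ≤-trans (sum-map-≤ lows (payees-≤2 ∘ ∈-lows⁻)) (≤-reflexive (sum-map-const 2 lows))

    payments : sum (map (length ∘ payees) lows) ≡ sum (map (length ∘ payers) highs)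
    payments = double-count pays? lows highs

  -- The total payment is at least twice the number of high vertices and at most twice the number of
  -- low ones; `WellPaid` makes one of the two bounds strict.
  high⇒highs<lows : ∀ {v} → High v → length highs < length lows
  high⇒highs<lows {v} high = ℕ.*-cancelʳ-< 2 _ _ (strict (HighVertex.well-paid F free high))
    where
    strict : HighVertex.WellPaid F free high → length highs * 2 < length lows * 2
    strict (inj₁ 3≤) = begin-strict
      length highs * 2                   ≡⟨ sum-map-const 2 highs ⟨
      sum (map (const 2) highs)          <⟨ sum-map-< (paid-twice ∘ ∈-highs⁻) (∈-highs⁺ high) 3≤ ⟩
      sum (map (length ∘ payers) highs)  ≡⟨ payments ⟨
      sum (map (length ∘ payees) lows)   ≤⟨ ≤2*lows ⟩
      length lows * 2                    ∎
      where open ≤-Reasoning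
    strict (inj₂ (_ , x , low , ≤1)) = begin-strict
      length highs * 2                   ≤⟨ 2*highs≤ ⟩
      sum (map (length ∘ payers) highs)  ≡⟨ payments ⟨
      sum (map (length ∘ payees) lows)   <⟨ sum-map-< (payees-≤2 ∘ ∈-lows⁻) (∈-lows⁺ low) (s≤s ≤1) ⟩
      sum (map (const 2) lows)           ≡⟨ sum-map-const 2 lows ⟩
      length lows * 2                    ∎
      where open ≤-Reasoning

  highs≤lows : length highs ≤ length lows
  highs≤lows with any? high?
  ... | yes (_ , high) = ℕ.<⇒≤ (high⇒highs<lows high)
  ... | no ¬high = unique-⊆⇒length-≤ {ys = lows} highs-unique λ v∈ → contradiction (_ , ∈-highs⁻ v∈) ¬high

-- Components of P₇-free graphs with minimum degree at least three

module _ {a r} {A : Set a} {R : A → A → Set r} where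

  linked-++⁻ˡ : ∀ xs {ys} → Linked R (xs ++ ys) → Linked R xs
  linked-++⁻ˡ []           _        = []
  linked-++⁻ˡ (x ∷ [])     _        = [-]
  linked-++⁻ˡ (x ∷ y ∷ xs) (r ∷ rs) = r ∷ linked-++⁻ˡ (y ∷ xs) rs

  linked-++⁻ʳ : ∀ xs {ys} → Linked R (xs ++ ys) → Linked R ys
  linked-++⁻ʳ []       rs = rs
  linked-++⁻ʳ (x ∷ xs) rs = linked-++⁻ʳ xs (Linked.tail rs)

  linked-join : ∀ xs {y ys} → Linked R (xs ++ [ y ]) → Linked R (y ∷ ys) → Linked R (xs ++ y ∷ ys)
  linked-join []           _        ss = ss
  linked-join (x ∷ [])     (r ∷ _)  ss = r ∷ ss
  linked-join (x ∷ y ∷ xs) (r ∷ rs) ss = r ∷ linked-join (y ∷ xs) rs ss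

  -- A cycle written twice in a row is still a walk, and the rotation starting at `z` is a segment
  -- of it.
  rotate : ∀ {x xs z} → Linked R (x ∷ xs ++ [ x ]) → z ∈ x ∷ xs →
           ∃ λ zs → z ∷ zs ↭ x ∷ xs × Linked R (z ∷ zs)
  rotate {x} {xs} {z} cyc = go (linked-join (x ∷ xs) cyc (linked-++⁻ˡ (x ∷ xs) cyc))
    where
    go : ∀ {cs} → Linked R (cs ++ cs) → z ∈ cs → ∃ λ zs → z ∷ zs ↭ cs × Linked R (z ∷ zs)
    go twice z∈cs with ∈-∃++ z∈cs
    ... | ps , qs , refl = qs ++ ps , ++-comm (z ∷ qs) ps ,
      linked-++⁻ˡ (z ∷ qs ++ ps) (subst (Linked R) (sym (++-assoc (z ∷ qs) ps (z ∷ qs)))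
        (linked-++⁻ʳ ps (subst (Linked R) (++-assoc ps (z ∷ qs) (ps ++ z ∷ qs)) twice)))

module SmallComponents {n : ℕ} (F : Graph n) (free : Degrees.P₇-free F) (deg≥3 : ∀ v → 3 ≤ Degrees.deg F v) where

  open Degrees F

  Connected : Fin n → Fin n → Set
  Connected = Star _~_

  -- The vertex set of a path being grown. The path is reordered again and again, so only connection
  -- to the fixed root `v` is recorded.
  record Cluster (v : Fin n) (xs : List (Fin n)) : Set where
    field
      unique    : Unique xs
      root      : v ∈ xs
      connected : ∀ {x} → x ∈ xs → Connected v x
  open Cluster

  record Component (v : Fin n) : Set where
    field
      {members} : List (Fin n)
      cluster   : Cluster v members
      small     : length members ≤ 6
      closed    : ∀ {x y} → x ∈ members → x ~ y → y ∈ members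
  open Component

  -- A duplicate-free list inside `xs` of the same length has the same members, so it still contains
  -- the root.
  rearrange : ∀ {v xs ys} → Cluster v xs → Unique ys → ys ⊆ xs → length xs ≡ length ys → Cluster v ys
  rearrange C ys! ys⊆xs eq .unique       = ys!
  rearrange C ys! ys⊆xs eq .root         = ⊆-length⇒⊇ ys! ys⊆xs (≤-reflexive eq) (C .root)
  rearrange C ys! ys⊆xs eq .connected y∈ = C .connected (ys⊆xs y∈)

  rearrange-↭ : ∀ {v xs ys} → Cluster v xs → ys ↭ xs → Cluster v ys
  rearrange-↭ C ys↭xs = rearrange C (Permutation.Unique-resp-↭ (setoid (Fin n)) (↭⇒↭ₛ (↭-sym ys↭xs)) (C .unique))
    (∈-resp-↭ ys↭xs) (sym (↭-length ys↭xs))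

  rearrange-select : ∀ {v xs} → Cluster v xs → ∀ is {_ : True (DecUnique.unique? _≟_ is)} → length xs ≡ length is →
                     Cluster v (select xs is)
  rearrange-select {xs = xs} C is {is!} eq = rearrange C (select-unique (C .unique) is {is!}) (select-⊆ xs is)
    (trans eq (sym (length-map (lookup xs) is)))

  extend : ∀ {v xs x y} → Cluster v xs → x ∈ xs → x ~ y → y ∉ xs → Cluster v (y ∷ xs)
  extend C x∈ x~y y∉ .unique = unique-∷ y∉ (C .unique)
  extend C x∈ x~y y∉ .root   = there (C .root)
  extend C x∈ x~y y∉ .connected (here refl) = C .connected x∈ ◅◅ (x~y ◅ ε)
  extend C x∈ x~y y∉ .connected (there z∈)  = C .connected z∈

  Longer Cyclic : Fin n → ℕ → Set
  Longer v k = ∃ λ xs → Cluster v xs × Linked _~_ xs × length xs ≡ suc k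
  Cyclic v k = ∃ λ x → ∃ λ xs → Cluster v (x ∷ xs) × Linked _~_ (x ∷ xs ++ [ x ]) × length (x ∷ xs) ≡ k

  nbr-within : ∀ {x xs} ys → {True (length ys ≤? 2)} → (∀ {w} → x ~ w → w ∈ xs) → ∃ λ w → x ~ w × w ∈ xs × w ∉ ys
  nbr-within {x} ys {l} closed with nbr-outside {x} ys (≤-trans (s≤s (toWitness l)) (deg≥3 x))
  ... | w , x~w , w∉ = w , x~w , closed x~w , w∉

  end-closed? : ∀ x xs → (∃ λ y → x ~ y × y ∉ xs) ⊎ (∀ {y} → x ~ y → y ∈ xs)
  end-closed? x xs with ⊆-or-∉ (nbrs x) xs
  ... | inj₁ ⊆xs            = inj₂ λ x~y → ⊆xs (∈-nbrs⁺ x~y)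
  ... | inj₂ (y , y∈ , y∉) = inj₁ (y , ∈-nbrs⁻ y∈ , y∉)

  -- Pósa's crossing argument: on a path with both ends closed the two ends have total degree at least six, so for some i
  -- the first vertex is adjacent to xᵢ₊₁ and the last one to xᵢ.

  close₄ : ∀ {v x₁ x₂ x₃ x₄} → let xs = x₁ ∷ x₂ ∷ x₃ ∷ x₄ ∷ [] in
           Cluster v xs → Linked _~_ xs → (∀ {y} → x₁ ~ y → y ∈ xs) → Cyclic v 4
  close₄ {v} {x₁} {x₂} {x₃} C (e₁ ∷ e₂ ∷ e₃ ∷ [-]) closed₁ with nbr-within (x₂ ∷ x₃ ∷ []) closed₁
  ... | _ , x₁~w , here w≡x₁ , _ = contradiction (sym w≡x₁) (~⇒≢ x₁~w)
  ... | _ , _ , there (here p) , w∉ = contradiction (here p) w∉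
  ... | _ , _ , there (there (here p)) , w∉ = contradiction (there (here p)) w∉
  ... | _ , x₁~x₄ , there (there (there (here refl))) , _ = _ , _ , C , e₁ ∷ e₂ ∷ e₃ ∷ ~-sym x₁~x₄ ∷ [-] , refl

  close₅ : ∀ {v x₁ x₂ x₃ x₄ x₅} → let xs = x₁ ∷ x₂ ∷ x₃ ∷ x₄ ∷ x₅ ∷ [] in
           Cluster v xs → Linked _~_ xs → (∀ {y} → x₁ ~ y → y ∈ xs) → (∀ {y} → x₅ ~ y → y ∈ xs) → Cyclic v 5
  close₅ {v} {x₁} {x₂} {x₃} {x₄} {x₅} C (e₁ ∷ e₂ ∷ e₃ ∷ e₄ ∷ [-]) closed₁ closed₅ = from-x₁ (nbr-within (x₂ ∷ x₃ ∷ []) closed₁)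
    where
    xs : List (Fin n)
    xs = x₁ ∷ x₂ ∷ x₃ ∷ x₄ ∷ x₅ ∷ []
    cycle₄ : x₁ ~ x₅ → Cyclic v 5
    cycle₄ x₁~x₅ = _ , _ , C , e₁ ∷ e₂ ∷ e₃ ∷ e₄ ∷ ~-sym x₁~x₅ ∷ [-] , refl
    from-x₅ : x₁ ~ x₄ → (∃ λ w → x₅ ~ w × w ∈ xs × w ∉ x₂ ∷ x₄ ∷ []) → Cyclic v 5
    from-x₅ _ (_ , x₅~x₁ , here refl , _) = cycle₄ (~-sym x₅~x₁)
    from-x₅ _ (_ , _ , there (here p) , w∉) = contradiction (here p) w∉
    from-x₅ x₁~x₄ (_ , x₅~x₃ , there (there (here refl)) , _) =
      _ , _ , rearrange-select C (0F ∷ 1F ∷ 2F ∷ 4F ∷ 3F ∷ []) refl ,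
      e₁ ∷ e₂ ∷ ~-sym x₅~x₃ ∷ ~-sym e₄ ∷ ~-sym x₁~x₄ ∷ [-] , refl
    from-x₅ _ (_ , _ , there (there (there (here p))) , w∉) = contradiction (there (here p)) w∉
    from-x₅ _ (_ , x₅~w , there (there (there (there (here w≡x₅)))) , _) = contradiction (sym w≡x₅) (~⇒≢ x₅~w)
    from-x₁ : (∃ λ w → x₁ ~ w × w ∈ xs × w ∉ x₂ ∷ x₃ ∷ []) → Cyclic v 5
    from-x₁ (_ , x₁~w , here w≡x₁ , _) = contradiction (sym w≡x₁) (~⇒≢ x₁~w)
    from-x₁ (_ , _ , there (here p) , w∉) = contradiction (here p) w∉
    from-x₁ (_ , _ , there (there (here p)) , w∉) = contradiction (there (here p)) w∉
    from-x₁ (_ , x₁~x₄ , there (there (there (here refl))) , _) = from-x₅ x₁~x₄ (nbr-within (x₂ ∷ x₄ ∷ []) closed₅)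
    from-x₁ (_ , x₁~x₅ , there (there (there (there (here refl)))) , _) = cycle₄ x₁~x₅

  close₆ : ∀ {v x₁ x₂ x₃ x₄ x₅ x₆} → let xs = x₁ ∷ x₂ ∷ x₃ ∷ x₄ ∷ x₅ ∷ x₆ ∷ [] in
           Cluster v xs → Linked _~_ xs → (∀ {y} → x₁ ~ y → y ∈ xs) → (∀ {y} → x₆ ~ y → y ∈ xs) → Cyclic v 6
  close₆ {v} {x₁} {x₂} {x₃} {x₄} {x₅} {x₆} C (e₁ ∷ e₂ ∷ e₃ ∷ e₄ ∷ e₅ ∷ [-]) closed₁ closed₆ =
    by-cases (x₁ ~? x₃) (x₁ ~? x₄) (x₁ ~? x₅)
    where
    cycle₂ : x₁ ~ x₃ → x₆ ~ x₂ → Cyclic v 6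
    cycle₂ x₁~x₃ x₆~x₂ = _ , _ , rearrange-select C (0F ∷ 2F ∷ 3F ∷ 4F ∷ 5F ∷ 1F ∷ []) refl ,
      x₁~x₃ ∷ e₃ ∷ e₄ ∷ e₅ ∷ x₆~x₂ ∷ ~-sym e₁ ∷ [-] , refl
    cycle₃ : x₁ ~ x₄ → x₆ ~ x₃ → Cyclic v 6
    cycle₃ x₁~x₄ x₆~x₃ = _ , _ , rearrange-select C (0F ∷ 3F ∷ 4F ∷ 5F ∷ 2F ∷ 1F ∷ []) refl ,
      x₁~x₄ ∷ e₄ ∷ e₅ ∷ x₆~x₃ ∷ ~-sym e₂ ∷ ~-sym e₁ ∷ [-] , refl
    cycle₄ : x₁ ~ x₅ → x₆ ~ x₄ → Cyclic v 6
    cycle₄ x₁~x₅ x₆~x₄ = _ , _ , rearrange-select C (0F ∷ 4F ∷ 5F ∷ 3F ∷ 2F ∷ 1F ∷ []) refl ,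
      x₁~x₅ ∷ e₅ ∷ x₆~x₄ ∷ ~-sym e₃ ∷ ~-sym e₂ ∷ ~-sym e₁ ∷ [-] , refl
    cycle₅ : x₁ ~ x₆ → Cyclic v 6
    cycle₅ x₁~x₆ = _ , _ , C , e₁ ∷ e₂ ∷ e₃ ∷ e₄ ∷ e₅ ∷ ~-sym x₁~x₆ ∷ [-] , refl

    from-x₁ : ∀ p → (x₃ ≢ p → ¬ x₁ ~ x₃) → (x₄ ≢ p → ¬ x₁ ~ x₄) → (x₅ ≢ p → ¬ x₁ ~ x₅) → Cyclic v 6
    from-x₁ p ¬₃ ¬₄ ¬₅ with nbr-within (x₂ ∷ p ∷ []) closed₁
    ... | _ , x₁~w , here w≡x₁ , _ = contradiction (sym w≡x₁) (~⇒≢ x₁~w)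
    ... | _ , _ , there (here q) , w∉ = contradiction (here q) w∉
    ... | _ , x₁~x₃ , there (there (here refl)) , w∉ = contradiction x₁~x₃ (¬₃ (w∉ ∘ there ∘ here))
    ... | _ , x₁~x₄ , there (there (there (here refl))) , w∉ = contradiction x₁~x₄ (¬₄ (w∉ ∘ there ∘ here))
    ... | _ , x₁~x₅ , there (there (there (there (here refl)))) , w∉ = contradiction x₁~x₅ (¬₅ (w∉ ∘ there ∘ here))
    ... | _ , x₁~x₆ , there (there (there (there (there (here refl))))) , _ = cycle₅ x₁~x₆

    from-x₆ : ∀ p → (x₂ ≢ p → x₆ ~ x₂ → Cyclic v 6) → (x₃ ≢ p → x₆ ~ x₃ → Cyclic v 6) → (x₄ ≢ p → x₆ ~ x₄ → Cyclic v 6) → Cyclic v 6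
    from-x₆ p k₂ k₃ k₄ with nbr-within (x₅ ∷ p ∷ []) closed₆
    ... | _ , x₆~x₁ , here refl , _ = cycle₅ (~-sym x₆~x₁)
    ... | _ , x₆~x₂ , there (here refl) , w∉ = k₂ (w∉ ∘ there ∘ here) x₆~x₂
    ... | _ , x₆~x₃ , there (there (here refl)) , w∉ = k₃ (w∉ ∘ there ∘ here) x₆~x₃
    ... | _ , x₆~x₄ , there (there (there (here refl))) , w∉ = k₄ (w∉ ∘ there ∘ here) x₆~x₄
    ... | _ , _ , there (there (there (there (here q)))) , w∉ = contradiction (here q) w∉
    ... | _ , x₆~w , there (there (there (there (there (here w≡x₆))))) , _ = contradiction (sym w≡x₆) (~⇒≢ x₆~w)

    -- If x₁ has two neighbours among x₃, x₄, x₅, their predecessors are two of x₂, x₃, x₄; the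
    -- third is taken as `p`, so a neighbour of x₆ other than x₅ and `p` crosses or is x₁. Otherwise
    -- `p` is the only possible neighbour of x₁ among the three, and x₁ must be adjacent to x₆.
    by-cases : Dec (x₁ ~ x₃) → Dec (x₁ ~ x₄) → Dec (x₁ ~ x₅) → Cyclic v 6
    by-cases (yes x₁~x₃) (yes x₁~x₄) _ = from-x₆ x₄ (const (cycle₂ x₁~x₃)) (const (cycle₃ x₁~x₄)) (λ ≢ → contradiction refl ≢)
    by-cases (yes x₁~x₃) (no _) (yes x₁~x₅) = from-x₆ x₃ (const (cycle₂ x₁~x₃)) (λ ≢ → contradiction refl ≢) (const (cycle₄ x₁~x₅))
    by-cases (no _) (yes x₁~x₄) (yes x₁~x₅) = from-x₆ x₂ (λ ≢ → contradiction refl ≢) (const (cycle₃ x₁~x₄)) (const (cycle₄ x₁~x₅))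
    by-cases (yes _) (no x₁≁x₄) (no x₁≁x₅) = from-x₁ x₃ (λ ≢ → contradiction refl ≢) (const x₁≁x₄) (const x₁≁x₅)
    by-cases (no x₁≁x₃) (yes _) (no x₁≁x₅) = from-x₁ x₄ (const x₁≁x₃) (λ ≢ → contradiction refl ≢) (const x₁≁x₅)
    by-cases (no x₁≁x₃) (no x₁≁x₄) _ = from-x₁ x₅ (const x₁≁x₃) (const x₁≁x₄) (λ ≢ → contradiction refl ≢)

  -- The closed end has three neighbours on the path, which thus has four to six vertices. On four
  -- vertices `x` is adjacent to the last one. On five or six, either the reversed path can be
  -- extended or both ends are closed.
  close-path : ∀ {v x xs} → Cluster v (x ∷ xs) → Linked _~_ (x ∷ xs) → length (x ∷ xs) ≤ 6 →
               (∀ {y} → x ~ y → y ∈ x ∷ xs) → Longer v (length (x ∷ xs)) ⊎ Cyclic v (length (x ∷ xs))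
  close-path {v} {x} {xs} C path len closed = go xs C path len closed
    (≤-trans (deg≥3 x) (deg-≤ xs λ x~w → ∈-∷⁻ (closed x~w) (~⇒≢ x~w ∘ sym)))
    where
    go : ∀ xs → Cluster v (x ∷ xs) → Linked _~_ (x ∷ xs) → length (x ∷ xs) ≤ 6 → (∀ {y} → x ~ y → y ∈ x ∷ xs) → 3 ≤ length xs →
         Longer v (length (x ∷ xs)) ⊎ Cyclic v (length (x ∷ xs))
    go (_ ∷ []) C path len closed (s≤s ())
    go (_ ∷ _ ∷ []) C path len closed (s≤s (s≤s ()))
    go (_ ∷ _ ∷ _ ∷ []) C path len closed _ = inj₂ (close₄ C path closed)
    go (_ ∷ _ ∷ _ ∷ x₅ ∷ []) C path@(e₁ ∷ e₂ ∷ e₃ ∷ e₄ ∷ [-]) len closed _ with end-closed? x₅ _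
    ... | inj₁ (y , x₅~y , y∉) = inj₁ (_ , rearrange-select (extend C (there (there (there (there (here refl))))) x₅~y y∉)
            (0F ∷ 5F ∷ 4F ∷ 3F ∷ 2F ∷ 1F ∷ []) refl , ~-sym x₅~y ∷ ~-sym e₄ ∷ ~-sym e₃ ∷ ~-sym e₂ ∷ ~-sym e₁ ∷ [-] , refl)
    ... | inj₂ closed₅ = inj₂ (close₅ C path closed closed₅)
    go (_ ∷ _ ∷ _ ∷ _ ∷ x₆ ∷ []) C path@(e₁ ∷ e₂ ∷ e₃ ∷ e₄ ∷ e₅ ∷ [-]) len closed _ with end-closed? x₆ _
    ... | inj₁ (y , x₆~y , y∉) = inj₁ (_ , rearrange-select (extend C (there (there (there (there (there (here refl)))))) x₆~y y∉)
            (0F ∷ 6F ∷ 5F ∷ 4F ∷ 3F ∷ 2F ∷ 1F ∷ []) refl ,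
            ~-sym x₆~y ∷ ~-sym e₅ ∷ ~-sym e₄ ∷ ~-sym e₃ ∷ ~-sym e₂ ∷ ~-sym e₁ ∷ [-] , refl)
    ... | inj₂ closed₆ = inj₂ (close₆ C path closed closed₆)
    go (_ ∷ _ ∷ _ ∷ _ ∷ _ ∷ _ ∷ _) _ _ (s≤s (s≤s (s≤s (s≤s (s≤s (s≤s ())))))) _ _

  -- `k` is the number of vertices missing to a forbidden path on seven. When the path closes to a
  -- cycle, an edge leaving the cycle gives a longer path by opening the cycle at the end of that
  -- edge; without such an edge the cycle spans a component.
  grow : ∀ {v xs} k → length xs + k ≡ 7 → Cluster v xs → Linked _~_ xs → Component v
  grow zero eq C path = ⊥-elim (free _ (trans (sym (ℕ.+-identityʳ _)) eq) (C .unique) path)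
  grow {xs = []} (suc k) eq C path with () ← C .root
  grow {v} {x ∷ xs} (suc k) eq C path with end-closed? x (x ∷ xs)
  ... | inj₁ (y , x~y , y∉) = grow {xs = y ∷ x ∷ xs} k (trans (sym (+-suc _ k)) eq) (extend C (here refl) x~y y∉) (~-sym x~y ∷ path)
  ... | inj₂ closed-end = finish (close-path C path len closed-end)
    where
    len : length (x ∷ xs) ≤ 6
    len = ℕ.s≤s⁻¹ (≤-trans (s≤s (ℕ.m≤m+n _ k)) (≤-reflexive (trans (sym (+-suc _ k)) eq)))
    finish : Longer v (length (x ∷ xs)) ⊎ Cyclic v (length (x ∷ xs)) → Component v
    finish (inj₁ (ys , D , path′ , len≡)) = grow k (trans (cong (_+ k) len≡) (trans (sym (+-suc _ k)) eq)) D path′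
    finish (inj₂ (c , cs , D , cyc , len≡)) with any? (λ y → ¬? (y ∈? (c ∷ cs)) ×-dec any? (λ z → z ∈? (c ∷ cs) ×-dec z ~? y))
    ... | no none = record
      { cluster = D
      ; small   = subst (_≤ 6) (sym len≡) len
      ; closed  = λ {z} {y} z∈ z~y → decidable-stable (y ∈? (c ∷ cs)) λ y∉ → none (y , y∉ , z , z∈ , z~y) }
    ... | yes (y , y∉ , z , z∈ , z~y) with rotate cyc z∈
    ... | zs , zs↭ , path′ = grow {xs = y ∷ z ∷ zs} k (trans (cong (λ l → suc l + k) (trans (↭-length zs↭) len≡)) (trans (sym (+-suc _ k)) eq))
            (extend (rearrange-↭ D zs↭) (here refl) z~y (y∉ ∘ ∈-resp-↭ zs↭)) (~-sym z~y ∷ path′)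

  component : ∀ v → Component v
  component v = grow {xs = v ∷ []} 6 refl
    (record { unique = [] ∷ [] ; root = here refl ; connected = λ { (here refl) → ε } }) [-]

  connected⇒member : ∀ {v x y} (K : Component v) → x ∈ K .members → Connected x y → y ∈ K .members
  connected⇒member K x∈ ε            = x∈
  connected⇒member K x∈ (x~z ◅ z⋯y) = connected⇒member K (K .closed x∈ x~z) z⋯y

  connected? : ∀ u v → Dec (Connected u v)
  connected? u v = map′ (K .cluster .connected) (connected⇒member K (K .cluster .root)) (v ∈? K .members)
    where
    K : Component u
    K = component u

  connected-≤6 : ∀ {v xs} → Unique xs → (∀ {x} → x ∈ xs → Connected v x) → length xs ≤ 6
  connected-≤6 {v} xs! conn = ≤-trans (unique-⊆⇒length-≤ xs! (connected⇒member K (K .cluster .root) ∘ conn)) (K .small)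
    where
    K : Component v
    K = component v

-- Edge colourings of bipartite multigraphs

free-colour : ∀ {k} (used : List (Fin k)) → length used < k → ∃ λ γ → γ ∉ used
free-colour {k} used len with longer⇒∃∉ (Unique.allFin⁺ k) (subst (length used <_) (sym (length-tabulate id)) len)
... | γ , _ , γ∉ = γ , γ∉

punch-view : ∀ {n} (v w : Fin (suc n)) → w ≡ v ⊎ ∃ λ j → w ≡ punchIn v j
punch-view v w with v ≟ w
... | yes v≡w = inj₁ (sym v≡w)
... | no  v≢w = inj₂ (punchOut v≢w , sym (punchIn-punchOut v≢w))

-- The set grows from `w` one element at a time, each with a recorded predecessor. Since `d` starts
-- at `n` when there is one element, it reaches zero only with more than `n` distinct elements.
closure : ∀ {n} {K : Fin n → Fin n → Set} → (∀ x y → Dec (K x y)) → ∀ w →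
          ∃ λ S → w ∈ S × (∀ {x y} → x ∈ S → K x y → y ∈ S) × (∀ {x} → x ∈ S → x ≡ w ⊎ ∃ λ y → y ∈ S × K y x)
closure {n} {K} K? w = go n refl ([] ∷ []) (here refl) λ { (here eq) → inj₁ eq }
  where
  go : ∀ {S} d → length S + d ≡ suc n → Unique S → w ∈ S → (∀ {x} → x ∈ S → x ≡ w ⊎ ∃ λ y → y ∈ S × K y x) →
       ∃ λ S → w ∈ S × (∀ {x y} → x ∈ S → K x y → y ∈ S) × (∀ {x} → x ∈ S → x ≡ w ⊎ ∃ λ y → y ∈ S × K y x)
  go zero eq S! _ _ = contradiction (unique⇒length-≤ S!) (<⇒≱ (≤-reflexive (trans (sym eq) (ℕ.+-identityʳ _))))
  go {S} (suc d) eq S! w∈ origin with any? (λ x → any? (λ y → x ∈? S ×-dec K? x y ×-dec ¬? (y ∈? S)))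
  ... | no none = S , w∈ , (λ {x} {y} x∈ Kxy → decidable-stable (y ∈? S) λ y∉ → none (x , y , x∈ , Kxy , y∉)) , origin
  ... | yes (x , y , x∈ , Kxy , y∉) = go {y ∷ S} d (trans (sym (+-suc _ d)) eq) (unique-∷ y∉ S!) (there w∈) origin′
    where
    origin′ : ∀ {z} → z ∈ y ∷ S → z ≡ w ⊎ ∃ λ u → u ∈ y ∷ S × K u z
    origin′ (here refl) = inj₂ (x , there x∈ , Kxy)
    origin′ (there z∈) with origin z∈
    ... | inj₁ z≡w            = inj₁ z≡w
    ... | inj₂ (u , u∈ , Kuz) = inj₂ (u , there u∈ , Kuz)

-- One side of the bipartite multigraph: its vertices are the classes, `bounded` limits their degree
-- by `k`, and `Rainbow` says that an edge colouring is proper at this side.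
record Partition (n k : ℕ) : Set₁ where
  field
    _≈_     : Fin n → Fin n → Set
    _≈?_    : ∀ u v → Dec (u ≈ v)
    ≈-refl  : ∀ {u} → u ≈ u
    ≈-sym   : ∀ {u v} → u ≈ v → v ≈ u
    ≈-trans : ∀ {u v w} → u ≈ v → v ≈ w → u ≈ w
    bounded : ∀ {v xs} → Unique xs → (∀ {x} → x ∈ xs → v ≈ x) → length xs ≤ k

  Rainbow : (Fin n → Fin k) → Set
  Rainbow col = ∀ {u v} → u ≈ v → col u ≡ col v → u ≡ v

open Partition using (Rainbow; bounded)

restrict : ∀ {m n k} (f : Fin m → Fin n) → (∀ {i j} → f i ≡ f j → i ≡ j) → Partition n k → Partition m k
restrict f f-inj P = record
  { _≈_     = λ i j → f i ≈ f j
  ; _≈?_    = λ i j → f i ≈? f j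
  ; ≈-refl  = ≈-refl
  ; ≈-sym   = ≈-sym
  ; ≈-trans = ≈-trans
  ; bounded = λ {v} {xs} xs! h → subst (_≤ _) (length-map f xs)
                (bounded P {f v} (Unique.map⁺ f-inj xs!) λ x∈ → let _ , y∈ , eq = ∈-map⁻ f x∈ in subst (f v ≈_) (sym eq) (h y∈))
  }
  where open Partition P

delete : ∀ {n k} → Fin (suc n) → Partition (suc n) k → Partition n k
delete v = restrict (punchIn v) (punchIn-injective v _ _)

-- The class of `v` has at most `k` members including `v`, so the others use fewer than `k` colours.
missing-colour : ∀ {n k} (P : Partition (suc n) k) (v : Fin (suc n)) (col : Fin n → Fin k) →
                 ∃ λ γ → ∀ {j} → Partition._≈_ P v (punchIn v j) → col j ≢ γ
missing-colour {n} {k} P v col = γ , λ v≈j col≡γ → γ∉ (subst (_∈ map col class) col≡γ (∈-map⁺ col (∈-filter⁺ in-class? (∈-allFin _) v≈j)))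
  where
  open Partition P hiding (bounded)
  in-class? : ∀ j → Dec (v ≈ punchIn v j)
  in-class? j = v ≈? punchIn v j
  class : List (Fin n)
  class = filter in-class? (allFin n)
  class< : length class < k
  class< = subst (λ l → suc l ≤ k) (length-map (punchIn v) class) (bounded P {v} {v ∷ map (punchIn v) class}
    (unique-∷ (λ v∈ → let _ , _ , eq = ∈-map⁻ (punchIn v) v∈ in punchInᵢ≢i v _ (sym eq))
      (Unique.map⁺ (punchIn-injective v _ _) (Unique.filter⁺ in-class? (Unique.allFin⁺ n))))
    λ { (here refl) → ≈-refl
      ; (there x∈) → let _ , j∈ , eq = ∈-map⁻ (punchIn v) x∈ in
                      subst (v ≈_) (sym eq) (proj₂ (∈-filter⁻ in-class? {xs = allFin n} j∈)) })
  free = free-colour (map col class) (subst (_< k) (sym (length-map col class)) class<)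
  γ : Fin k
  γ = proj₁ free
  γ∉ : γ ∉ map col class
  γ∉ = proj₂ free

-- The points of Fin n are the edges of a bipartite multigraph whose two sides
-- are the classes of P and of Q, so the αβ-chain leaving the class p along
-- its β-edge enters every class of Q by a β-edge, and never reaches the class q.
module Kempe {n k : ℕ} (P Q : Partition n k) {col : Fin n → Fin k} (rainbowP : Rainbow P col) (rainbowQ : Rainbow Q col)
             {p q : Fin n → Set} (p? : Decidable p)
             (p-class : ∀ {x y} → p x → p y → Partition._≈_ P x y) (p-closed : ∀ {x y} → p x → Partition._≈_ P x y → p y)
             (q-closed : ∀ {x y} → q x → Partition._≈_ Q x y → q y)
             {α β : Fin k} (p-misses : ∀ {x} → p x → col x ≢ α) (q-misses : ∀ {x} → q x → col x ≢ β) where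

  open Partition P using () renaming (_≈_ to _≈ᴾ_; _≈?_ to _≈ᴾ?_; ≈-sym to ≈ᴾ-sym; ≈-trans to ≈ᴾ-trans)
  open Partition Q using () renaming (_≈_ to _≈ᴼ_; _≈?_ to _≈ᴼ?_; ≈-sym to ≈ᴼ-sym; ≈-trans to ≈ᴼ-trans)

  Result : Set
  Result = ∃ λ col′ → Rainbow P col′ × Rainbow Q col′ × ∃ λ γ → (∀ {x} → p x → col′ x ≢ γ) × (∀ {x} → q x → col′ x ≢ γ)

  -- Steps are directed, so the predecessor of an α-edge is a β-edge of its `Q` class and that of a
  -- β-edge an α-edge of its `P` class.
  Next : Fin n → Fin n → Set
  Next x y = (col x ≡ β × col y ≡ α × x ≈ᴼ y) ⊎ (col x ≡ α × col y ≡ β × x ≈ᴾ y)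

  next? : ∀ x y → Dec (Next x y)
  next? x y = (col x ≟ β ×-dec col y ≟ α ×-dec x ≈ᴼ? y) ⊎-dec (col x ≟ α ×-dec col y ≟ β ×-dec x ≈ᴾ? y)

  module Chain {w} (pw : p w) (w-β : col w ≡ β) (α≢β : α ≢ β) where

    private
      chain = closure next? w

    S : List (Fin n)
    S = proj₁ chain
    w∈S : w ∈ S
    w∈S = proj₁ (proj₂ chain)
    forward : ∀ {x y} → x ∈ S → Next x y → y ∈ S
    forward = proj₁ (proj₂ (proj₂ chain))
    origin : ∀ {x} → x ∈ S → x ≡ w ⊎ ∃ λ y → y ∈ S × Next y x
    origin = proj₂ (proj₂ (proj₂ chain))

    α-origin : ∀ {x} → x ∈ S → col x ≡ α → ∃ λ y → y ∈ S × col y ≡ β × y ≈ᴼ x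
    α-origin x∈ x-α with origin x∈
    ... | inj₁ refl = contradiction (trans (sym x-α) w-β) α≢β
    ... | inj₂ (y , y∈ , inj₁ (y-β , _ , y≈x)) = y , y∈ , y-β , y≈x
    ... | inj₂ (_ , _ , inj₂ (_ , x-β , _)) = contradiction (trans (sym x-α) x-β) α≢β

    β-origin : ∀ {x} → x ∈ S → col x ≡ β → x ≡ w ⊎ ∃ λ y → y ∈ S × col y ≡ α × y ≈ᴾ x
    β-origin x∈ x-β with origin x∈
    ... | inj₁ x≡w = inj₁ x≡w
    ... | inj₂ (_ , _ , inj₁ (_ , x-α , _)) = contradiction (trans (sym x-α) x-β) α≢β
    ... | inj₂ (y , y∈ , inj₂ (y-α , _ , y≈x)) = inj₂ (y , y∈ , y-α , y≈x)

    -- An α-edge and a β-edge of the same class lie both in the chain or both outside, which makes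
    -- exchanging the colours on the chain safe.
    Flooded : (Fin n → Fin n → Set) → Set
    Flooded _≈_ = ∀ {x y} → x ∈ S → x ≈ y → (col x ≡ α × col y ≡ β) ⊎ (col x ≡ β × col y ≡ α) → y ∈ S

    -- Against the direction of the steps, `y` has the class and the colour of the predecessor of
    -- `x`, hence is that predecessor. The start `w` has none, but its class misses α.
    floodedᴾ : Flooded _≈ᴾ_
    floodedᴾ x∈ x≈y (inj₁ (x-α , y-β)) = forward x∈ (inj₂ (x-α , y-β , x≈y))
    floodedᴾ x∈ x≈y (inj₂ (x-β , y-α)) with β-origin x∈ x-β
    ... | inj₁ refl = contradiction y-α (p-misses (p-closed pw x≈y))
    ... | inj₂ (z , z∈ , z-α , z≈x) with refl ← rainbowP (≈ᴾ-trans z≈x x≈y) (trans z-α (sym y-α)) = z∈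

    floodedᴼ : Flooded _≈ᴼ_
    floodedᴼ x∈ x≈y (inj₂ (x-β , y-α)) = forward x∈ (inj₁ (x-β , y-α , x≈y))
    floodedᴼ x∈ x≈y (inj₁ (x-α , y-β)) with α-origin x∈ x-α
    ... | z , z∈ , z-β , z≈x with refl ← rainbowQ (≈ᴼ-trans z≈x x≈y) (trans z-β (sym y-β)) = z∈

    data Recoloured (x : Fin n) (c : Fin k) : Set where
      α→β  : x ∈ S → col x ≡ α → c ≡ β → Recoloured x c
      β→α  : x ∈ S → col x ≡ β → c ≡ α → Recoloured x c
      kept : x ∉ S → c ≡ col x → Recoloured x c

    recolour : ∀ x → ∃ (Recoloured x)
    recolour x with x ∈? S
    ... | no x∉ = col x , kept x∉ refl
    ... | yes x∈ with col x ≟ α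
    ...   | yes x-α = β , α→β x∈ x-α refl
    ...   | no ¬x-α = α , β→α x∈ (β-coloured (origin x∈)) refl
      where
      β-coloured : x ≡ w ⊎ (∃ λ y → y ∈ S × Next y x) → col x ≡ β
      β-coloured (inj₁ refl) = w-β
      β-coloured (inj₂ (_ , _ , inj₁ (_ , x-α , _))) = contradiction x-α ¬x-α
      β-coloured (inj₂ (_ , _ , inj₂ (_ , x-β , _))) = x-β

    col′ : Fin n → Fin k
    col′ = proj₁ ∘ recolour

    still-rainbow : ∀ {_≈_ : Fin n → Fin n → Set} → (∀ {x y} → x ≈ y → y ≈ x) → Flooded _≈_ →
                    (∀ {x y} → x ≈ y → col x ≡ col y → x ≡ y) → ∀ {x y} → x ≈ y → col′ x ≡ col′ y → x ≡ y
    still-rainbow {_≈_} ≈-sym flooded rainbow {x} {y} x≈y = compare (proj₂ (recolour x)) (proj₂ (recolour y))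
      where
      compare : ∀ {c d} → Recoloured x c → Recoloured y d → c ≡ d → x ≡ y
      compare (α→β _ x-α _)     (α→β _ y-α _)     _   = rainbow x≈y (trans x-α (sym y-α))
      compare (β→α _ x-β _)     (β→α _ y-β _)     _   = rainbow x≈y (trans x-β (sym y-β))
      compare (kept _ c≡)       (kept _ d≡)       c≡d = rainbow x≈y (trans (sym c≡) (trans c≡d d≡))
      compare (α→β _ _ refl)    (β→α _ _ refl)    c≡d = contradiction (sym c≡d) α≢β
      compare (β→α _ _ refl)    (α→β _ _ refl)    c≡d = contradiction c≡d α≢β
      compare (α→β x∈ x-α refl) (kept y∉ refl)    c≡d = contradiction (flooded x∈ x≈y (inj₁ (x-α , sym c≡d))) y∉
      compare (β→α x∈ x-β refl) (kept y∉ refl)    c≡d = contradiction (flooded x∈ x≈y (inj₂ (x-β , sym c≡d))) y∉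
      compare (kept x∉ refl)    (α→β y∈ y-α refl) c≡d = contradiction (flooded y∈ (≈-sym x≈y) (inj₁ (y-α , c≡d))) x∉
      compare (kept x∉ refl)    (β→α y∈ y-β refl) c≡d = contradiction (flooded y∈ (≈-sym x≈y) (inj₂ (y-β , c≡d))) x∉

    -- No α-edge of `p` exists to become β, and its only β-edge `w` becomes α.
    p-misses-β : ∀ {x} → p x → col′ x ≢ β
    p-misses-β {x} px = check (proj₂ (recolour x))
      where
      check : ∀ {c} → Recoloured x c → c ≢ β
      check (α→β _ x-α _)  _   = p-misses px x-α
      check (β→α _ _ refl) α≡β = α≢β α≡β
      check (kept x∉ refl) x-β with refl ← rainbowP (p-class px pw) (trans x-β (sym w-β)) = x∉ w∈S

    -- An α-edge of `q` on the chain would have been entered from a β-edge of the same class.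
    q-misses-β : ∀ {x} → q x → col′ x ≢ β
    q-misses-β {x} qx = check (proj₂ (recolour x))
      where
      check : ∀ {c} → Recoloured x c → c ≢ β
      check (α→β x∈ x-α _) _ with α-origin x∈ x-α
      ... | y , _ , y-β , y≈x = q-misses (q-closed qx (≈ᴼ-sym y≈x)) y-β
      check (β→α _ _ refl) α≡β = α≢β α≡β
      check (kept _ refl)  x-β = q-misses qx x-β

    result : Result
    result = col′ , still-rainbow ≈ᴾ-sym floodedᴾ rainbowP , still-rainbow ≈ᴼ-sym floodedᴼ rainbowQ , β , p-misses-β , q-misses-β

  common-missing : Result
  common-missing with any? (λ x → p? x ×-dec col x ≟ β)
  ... | no none = col , rainbowP , rainbowQ , β , (λ px x-β → none (_ , px , x-β)) , q-misses
  ... | yes (w , pw , w-β) = Chain.result pw w-β λ { refl → p-misses pw w-β }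

insert-rainbow : ∀ {n k} (P : Partition (suc n) k) (v : Fin (suc n)) {col : Fin n → Fin k} {γ} →
                 Rainbow (delete v P) col →
                 (∀ {j} → Partition._≈_ P v (punchIn v j) → col j ≢ γ) → Rainbow P (insertAt col v γ)
insert-rainbow P v {col} {γ} rainbow misses {x} {y} x≈y eq with punch-view v x | punch-view v y
... | inj₁ refl       | inj₁ refl       = refl
... | inj₁ refl       | inj₂ (j , refl) = contradiction
  (trans (sym (insertAt-punchIn col v γ j)) (trans (sym eq) (insertAt-lookup col v γ))) (misses x≈y)
... | inj₂ (i , refl) | inj₁ refl       = contradiction
  (trans (sym (insertAt-punchIn col v γ i)) (trans eq (insertAt-lookup col v γ))) (misses (Partition.≈-sym P x≈y))
... | inj₂ (i , refl) | inj₂ (j , refl) = cong (punchIn v)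
  (rainbow x≈y (trans (sym (insertAt-punchIn col v γ i)) (trans eq (insertAt-punchIn col v γ j))))

-- Induction on the number of edges: after the edge `0F` is removed, each of its two ends misses a
-- colour, and a Kempe exchange makes both miss the same one.
könig : ∀ {n k} (P Q : Partition n k) → ∃ λ col → Rainbow P col × Rainbow Q col
könig {zero} P Q = (λ ()) , (λ { {()} }) , (λ { {()} })
könig {suc n} P Q with könig (delete 0F P) (delete 0F Q)
... | col , rainbowP , rainbowQ with missing-colour P 0F col | missing-colour Q 0F col
... | α , p-misses | β , q-misses
  with Kempe.common-missing (delete 0F P) (delete 0F Q) rainbowP rainbowQ {q = λ j → Partition._≈_ Q 0F (suc j)}
         (λ j → Partition._≈?_ P 0F (suc j)) (λ px py → Partition.≈-trans P (Partition.≈-sym P px) py)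
         (Partition.≈-trans P) (Partition.≈-trans Q) p-misses q-misses
... | col′ , rainbowP′ , rainbowQ′ , γ , p-misses′ , q-misses′ =
  insertAt col′ 0F γ , insert-rainbow P 0F rainbowP′ p-misses′ , insert-rainbow Q 0F rainbowQ′ q-misses′

-- Colouring the union of two P₇-free graphs

open Degrees using (deg; P₇-free; High; Low; highs; lows; ∈-highs⁺; ∈-lows⁻; lows-unique)

low⇒high : ∀ {n} (A B : Graph n) → (∀ v → 8 ≤ deg A v + deg B v) → ∀ {v} → Low A v → High B v
low⇒high A B dense {v} low = ℕ.+-cancelˡ-≤ 2 6 (deg B v) (≤-trans (dense v) (ℕ.+-monoˡ-≤ (deg B v) low))

lows≤highs : ∀ {n} (A B : Graph n) → (∀ v → 8 ≤ deg A v + deg B v) → length (lows A) ≤ length (highs B)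
lows≤highs A B dense = unique-⊆⇒length-≤ (lows-unique A) (∈-highs⁺ B ∘ low⇒high A B dense ∘ ∈-lows⁻ A)

no-high : ∀ {n} (A B : Graph n) → P₇-free A → P₇-free B → (∀ v → 8 ≤ deg A v + deg B v) → ∀ {v} → ¬ High A v
no-high A B freeA freeB dense high = ℕ.<-irrefl refl (begin-strict
  length (highs A)  <⟨ high⇒highs<lows A freeA high ⟩
  length (lows A)   ≤⟨ lows≤highs A B dense ⟩
  length (highs B)  ≤⟨ highs≤lows B freeB ⟩
  length (lows B)   ≤⟨ lows≤highs B A (λ v → subst (8 ≤_) (ℕ.+-comm (deg A v) (deg B v)) (dense v)) ⟩
  length (highs A)  ∎)
  where open ≤-Reasoning

dense⇒deg≥3 : ∀ {n} (A B : Graph n) → P₇-free A → P₇-free B → (∀ v → 8 ≤ deg A v + deg B v) → ∀ v → 3 ≤ deg A v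
dense⇒deg≥3 A B freeA freeB dense v = ≰⇒> λ low →
  no-high B A freeB freeA (λ u → subst (8 ≤_) (ℕ.+-comm (deg A u) (deg B u)) (dense u)) (low⇒high A B dense low)

Proper : ∀ {n k} → Graph n → (Fin n → Fin k) → Set
Proper F col = ∀ u v → adj F u v ≡ true → col u ≢ col v

components : ∀ {n} (F : Graph n) → P₇-free F → (∀ v → 3 ≤ deg F v) → Partition n 8
components F free deg≥3 = record
  { _≈_     = Connected
  ; _≈?_    = connected?
  ; ≈-refl  = ε
  ; ≈-sym   = Star.reverse (Degrees.~-sym F)
  ; ≈-trans = _◅◅_
  -- Components have at most six vertices; the bound is relaxed to eight, the number of colours used
  -- for the union.
  ; bounded = λ xs! conn → ≤-trans (connected-≤6 xs! conn) (ℕ.m≤m+n 6 2)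
  }
  where open SmallComponents F free deg≥3

rainbow⇒proper : ∀ {n} (F : Graph n) free deg≥3 {col} → Rainbow (components F free deg≥3) col → Proper F col
rainbow⇒proper F free deg≥3 rainbow u v u~v eq = Degrees.~⇒≢ F u~v (rainbow (u~v ◅ ε) eq)

induced : ∀ {m n} → (Fin m → Fin n) → Graph n → Graph m
induced f F = record
  { adj    = λ i j → adj F (f i) (f j)
  ; sym    = λ i j → Graph.sym F (f i) (f j)
  ; irrefl = λ i → irrefl F (f i)
  }

induced-free : ∀ {m n} {f : Fin m → Fin n} → (∀ {i j} → f i ≡ f j → i ≡ j) → ∀ F → P₇-free F → P₇-free (induced f F)
induced-free {f = f} f-inj F free xs len xs! path =
  free (map f xs) (trans (length-map f xs) len) (Unique.map⁺ f-inj xs!) (Linked.map⁺ path)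

insert-proper : ∀ {n k} (F : Graph (suc n)) v {col : Fin n → Fin k} {γ} → Proper (induced (punchIn v) F) col →
                (∀ {j} → adj F v (punchIn v j) ≡ true → col j ≢ γ) → Proper F (insertAt col v γ)
insert-proper F v {col} {γ} proper misses x y x~y eq with punch-view v x | punch-view v y
... | inj₁ refl       | inj₁ refl       = Degrees.~⇒≢ F x~y refl
... | inj₁ refl       | inj₂ (j , refl) = misses x~y
  (trans (sym (insertAt-punchIn col v γ j)) (trans (sym eq) (insertAt-lookup col v γ)))
... | inj₂ (i , refl) | inj₁ refl       = misses (Degrees.~-sym F x~y)
  (trans (sym (insertAt-punchIn col v γ i)) (trans eq (insertAt-lookup col v γ)))
... | inj₂ (i , refl) | inj₂ (j , refl) = proper i j x~y
  (trans (sym (insertAt-punchIn col v γ i)) (trans eq (insertAt-punchIn col v γ j)))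

union-8-colourable : ∀ {n} (A B : Graph n) → P₇-free A → P₇-free B → ∃ λ (col : Fin n → Fin 8) → Proper A col × Proper B col
union-8-colourable {zero} A B _ _ = (λ ()) , (λ ()) , (λ ())
union-8-colourable {suc n} A B freeA freeB with any? (λ v → deg A v + deg B v ≤? 7)
... | no ¬sparse = let col , rainbowA , rainbowB = könig (components A freeA deg≥3A) (components B freeB deg≥3B) in
  col , rainbow⇒proper A freeA deg≥3A rainbowA , rainbow⇒proper B freeB deg≥3B rainbowB
  where
  dense : ∀ v → 8 ≤ deg A v + deg B v
  dense v = ≰⇒> λ sparse → ¬sparse (v , sparse)
  deg≥3A : ∀ v → 3 ≤ deg A v
  deg≥3A = dense⇒deg≥3 A B freeA freeB dense
  deg≥3B : ∀ v → 3 ≤ deg B v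
  deg≥3B = dense⇒deg≥3 B A freeB freeA λ v → subst (8 ≤_) (ℕ.+-comm (deg A v) (deg B v)) (dense v)
... | yes (v , sparse) with union-8-colourable (induced (punchIn v) A) (induced (punchIn v) B)
                              (induced-free (punchIn-injective v _ _) A freeA) (induced-free (punchIn-injective v _ _) B freeB)
... | col , properA , properB =
  insertAt col v γ , insert-proper A v properA (misses ∘ ∈-++⁺ˡ ∘ Degrees.∈-nbrs⁺ A) ,
                     insert-proper B v properB (misses ∘ ∈-++⁺ʳ (Degrees.nbrs A v) ∘ Degrees.∈-nbrs⁺ B)
  where
  nbrs : List (Fin (suc n))
  nbrs = Degrees.nbrs A v ++ Degrees.nbrs B v
  used : List (Fin 8)
  -- The colour `0F` at `v` is a placeholder, as `v` is not among its own neighbours.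
  used = map (insertAt col v 0F) nbrs
  fresh : ∃ λ γ → γ ∉ used
  fresh = free-colour used (s≤s (subst (_≤ 7) (sym (trans (length-map _ nbrs) (length-++ (Degrees.nbrs A v)))) sparse))
  γ : Fin 8
  γ = proj₁ fresh
  misses : ∀ {j} → punchIn v j ∈ nbrs → col j ≢ γ
  misses {j} j∈ col≡γ = proj₂ fresh (subst (_∈ used) (trans (insertAt-punchIn col v 0F j) col≡γ) (∈-map⁺ (insertAt col v 0F) j∈))

-- Monochromatic paths

layer : ∀ {n} (G : Graph n) → EdgeColouring (adj G) → Fin 2 → Graph n
layer G c k = record
  { adj    = λ u v → adj G u v ∧ does (colour c u v ≟ k)
  ; sym    = symmetric
  ; irrefl = λ v → cong (_∧ _) (irrefl G v)
  }
  where
  symmetric : ∀ u v → adj G u v ∧ does (colour c u v ≟ k) ≡ adj G v u ∧ does (colour c v u ≟ k)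
  -- Colours are symmetric only on edges, so non-edges are treated apart.
  symmetric u v with adj G u v in eq
  ... | false = sym (cong (_∧ _) (trans (Graph.sym G v u) eq))
  ... | true  = sym (cong₂ (λ a c → a ∧ does (c ≟ k)) (trans (Graph.sym G v u) eq) (sym (colour-sym c u v eq)))

layer⁻ : ∀ {n} (G : Graph n) c k u v → adj (layer G c k) u v ≡ true → adj G u v ≡ true × colour c u v ≡ k
layer⁻ G c k u v uv with adj G u v | colour c u v ≟ k
... | true | yes eq = refl , eq

layer⁺ : ∀ {n} (G : Graph n) c k u v → adj G u v ≡ true → colour c u v ≡ k → adj (layer G c k) u v ≡ true
layer⁺ G c k u v uv eq = trans (cong (_∧ _) uv) (dec-true (colour c u v ≟ k) eq)

linked-lookup : ∀ {a r} {A : Set a} {R : A → A → Set r} {xs} → Linked R xs →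
                ∀ i j → toℕ j ≡ suc (toℕ i) → R (lookup xs i) (lookup xs j)
linked-lookup (r ∷ _)  zero    (suc zero)    _  = r
linked-lookup (_ ∷ rs) (suc i) (suc (suc j)) eq = linked-lookup rs i (suc j) (ℕ.suc-injective eq)
linked-lookup (_ ∷ rs) (suc i) (suc zero)    ()
linked-lookup (_ ∷ rs) zero    (suc (suc _)) ()

P₇-free-or-path : ∀ {n} (F : Graph n) → P₇-free F ⊎ ∃ λ xs → length xs ≡ 7 × Unique xs × Linked (Degrees._~_ F) xs
P₇-free-or-path F with any? (λ x₁ → any? (λ x₂ → any? (λ x₃ → any? (λ x₄ → any? (λ x₅ → any? (λ x₆ → any? (λ x₇ →
  let xs = x₁ ∷ x₂ ∷ x₃ ∷ x₄ ∷ x₅ ∷ x₆ ∷ x₇ ∷ [] in DecUnique.unique? _≟_ xs ×-dec Linked.linked? (Degrees._~?_ F) xs)))))))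
... | yes (_ , _ , _ , _ , _ , _ , _ , xs! , path) = inj₂ (_ , refl , xs! , path)
... | no none = inj₁ λ { (_ ∷ _ ∷ _ ∷ _ ∷ _ ∷ _ ∷ _ ∷ []) _ xs! path → none (_ , _ , _ , _ , _ , _ , _ , xs! , path) }

adjP⁻ : ∀ m {i j} → adjP m i j ≡ true → toℕ j ≡ suc (toℕ i) ⊎ toℕ i ≡ suc (toℕ j)
adjP⁻ m {i} {j} ij with toℕ j ≡ᵇ suc (toℕ i) in eq
... | true  = inj₁ (ℕ.≡ᵇ⇒≡ _ _ (subst T (sym eq) _))
... | false = inj₂ (ℕ.≡ᵇ⇒≡ _ _ (subst T (sym ij) _))

path⇒mono : ∀ {n} (G : Graph n) c k xs → Unique xs → Linked (Degrees._~_ (layer G c k)) xs → MonoCopy (adjP (length xs)) (adj G) c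
path⇒mono G c k xs xs! path = k , lookup xs , lookup-injective xs! , edge
  where
  edge : ∀ i j → adjP (length xs) i j ≡ true → adj G (lookup xs i) (lookup xs j) ≡ true × colour c (lookup xs i) (lookup xs j) ≡ k
  edge i j ij with adjP⁻ (length xs) {i} {j} ij
  ... | inj₁ eq = layer⁻ G c k _ _ (linked-lookup path i j eq)
  ... | inj₂ eq = layer⁻ G c k _ _ (Degrees.~-sym (layer G c k) (linked-lookup path j i eq))

-- Give colour 1 to the edges meeting {0, 1}: then colour 0 lives on the at most
-- six other vertices, and a P₇ in colour 1 has three disjoint edges, each of
-- which would use up a vertex of {0, 1}.
arrows⇒9≤ : ∀ {N} → Arrows2 (adjP 7) N → 9 ≤ N
arrows⇒9≤ {N} arrows = ≰⇒> λ N≤8 → no-copy N≤8 (arrows c)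
  where
  small : Fin N → Bool
  small i = toℕ i <ᵇ 2

  c : EdgeColouring (adjK N)
  c .colour i j = if small i ∨ small j then 1F else 0F
  c .colour-sym i j _ = cong (if_then 1F else 0F) (Bool.∨-comm (small i) (small j))

  no-copy : N ≤ 8 → ¬ MonoCopy (adjP 7) (adjK N) c
  no-copy N≤8 (0F , f , f-inj , edges) = <⇒≱ (≤-refl {9}) (unique-⊆⇒length-≤ {xs = 0 ∷ 1 ∷ ys} {ys = upTo 8} xs! xs⊆)
    where
    ys : List ℕ
    ys = map (toℕ ∘ f) (allFin 7)
    large : ∀ i j → adjP 7 i j ≡ true → 2 ≤ toℕ (f i)
    large i j ij with small (f i) in eq | proj₂ (edges i j ij)
    ... | false | _ = ℕ.≮⇒≥ λ lt → subst T eq (ℕ.<⇒<ᵇ lt)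
    large′ : ∀ i → 2 ≤ toℕ (f i)
    large′ 0F = large 0F 1F refl
    large′ 1F = large 1F 0F refl
    large′ 2F = large 2F 1F refl
    large′ 3F = large 3F 2F refl
    large′ 4F = large 4F 3F refl
    large′ 5F = large 5F 4F refl
    large′ 6F = large 6F 5F refl
    ≥2 : ∀ {y} → y ∈ ys → 2 ≤ y
    ≥2 y∈ with i , _ , refl ← ∈-map⁻ (toℕ ∘ f) y∈ = large′ i
    xs! : Unique (0 ∷ 1 ∷ ys)
    xs! = unique-∷ (λ { (there 0∈) → contradiction (≥2 0∈) λ () })
         (unique-∷ (λ 1∈ → contradiction (≥2 1∈) λ { (s≤s ()) })
         (Unique.map⁺ (f-inj ∘ toℕ-injective) (Unique.allFin⁺ 7)))
    xs⊆ : 0 ∷ 1 ∷ ys ⊆ upTo 8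
    xs⊆ (here refl)         = here refl
    xs⊆ (there (here refl)) = there (here refl)
    xs⊆ (there (there y∈)) with i , _ , refl ← ∈-map⁻ (toℕ ∘ f) y∈ = ∈-upTo⁺ (<-≤-trans (toℕ<n (f i)) N≤8)
  no-copy N≤8 (1F , f , f-inj , edges) = clash (touch 0F 1F refl) (touch 2F 3F refl) (touch 4F 5F refl)
    where
    touch : ∀ i j → adjP 7 i j ≡ true → toℕ (f i) < 2 ⊎ toℕ (f j) < 2
    touch i j ij with small (f i) in eqᵢ | small (f j) in eqⱼ | proj₂ (edges i j ij)
    ... | true  | _    | _ = inj₁ (ℕ.<ᵇ⇒< _ _ (subst T (sym eqᵢ) _))
    ... | false | true | _ = inj₂ (ℕ.<ᵇ⇒< _ _ (subst T (sym eqⱼ) _))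
    at-most-two : ∀ is {_ : True (DecUnique.unique? _≟_ is)} → All (λ i → toℕ (f i) < 2) is → length is ≤ 2
    at-most-two is {is!} lt = subst (_≤ 2) (length-map (toℕ ∘ f) is)
      (unique-⊆⇒length-≤ {ys = upTo 2} (Unique.map⁺ (f-inj ∘ toℕ-injective) (toWitness is!))
        λ y∈ → let i , i∈ , eq = ∈-map⁻ (toℕ ∘ f) y∈ in subst (_∈ upTo 2) (sym eq) (∈-upTo⁺ (All.lookup lt i∈)))
    clash : toℕ (f 0F) < 2 ⊎ toℕ (f 1F) < 2 → toℕ (f 2F) < 2 ⊎ toℕ (f 3F) < 2 → toℕ (f 4F) < 2 ⊎ toℕ (f 5F) < 2 → ⊥
    clash (inj₁ p) (inj₁ q) (inj₁ r) = <⇒≱ ≤-refl (at-most-two (0F ∷ 2F ∷ 4F ∷ []) (p ∷ q ∷ r ∷ []))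
    clash (inj₁ p) (inj₁ q) (inj₂ r) = <⇒≱ ≤-refl (at-most-two (0F ∷ 2F ∷ 5F ∷ []) (p ∷ q ∷ r ∷ []))
    clash (inj₁ p) (inj₂ q) (inj₁ r) = <⇒≱ ≤-refl (at-most-two (0F ∷ 3F ∷ 4F ∷ []) (p ∷ q ∷ r ∷ []))
    clash (inj₁ p) (inj₂ q) (inj₂ r) = <⇒≱ ≤-refl (at-most-two (0F ∷ 3F ∷ 5F ∷ []) (p ∷ q ∷ r ∷ []))
    clash (inj₂ p) (inj₁ q) (inj₁ r) = <⇒≱ ≤-refl (at-most-two (1F ∷ 2F ∷ 4F ∷ []) (p ∷ q ∷ r ∷ []))
    clash (inj₂ p) (inj₁ q) (inj₂ r) = <⇒≱ ≤-refl (at-most-two (1F ∷ 2F ∷ 5F ∷ []) (p ∷ q ∷ r ∷ []))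
    clash (inj₂ p) (inj₂ q) (inj₁ r) = <⇒≱ ≤-refl (at-most-two (1F ∷ 3F ∷ 4F ∷ []) (p ∷ q ∷ r ∷ []))
    clash (inj₂ p) (inj₂ q) (inj₂ r) = <⇒≱ ≤-refl (at-most-two (1F ∷ 3F ∷ 5F ∷ []) (p ∷ q ∷ r ∷ []))

theorem5 : TwoGood (adjP 7)
theorem5 N (arrows , _) n G (_ , minimal) c with P₇-free-or-path (layer G c 0F) | P₇-free-or-path (layer G c 1F)
... | inj₂ (xs , len , xs! , path) | _ = subst (λ m → MonoCopy (adjP m) (adj G) c) len (path⇒mono G c 0F xs xs! path)
... | _ | inj₂ (xs , len , xs! , path) = subst (λ m → MonoCopy (adjP m) (adj G) c) len (path⇒mono G c 1F xs xs! path)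
... | inj₁ free₀ | inj₁ free₁ with union-8-colourable (layer G c 0F) (layer G c 1F) free₀ free₁
-- The common colouring is proper on `G`, so the chromatic number `N` is at most eight.
... | col , proper₀ , proper₁ = contradiction (minimal 8 (col , proper)) (<⇒≱ (arrows⇒9≤ arrows))
  where
  proper : ∀ u v → adj G u v ≡ true → col u ≢ col v
  proper u v uv with colour c u v in eq
  ... | 0F = proper₀ u v (layer⁺ G c 0F u v uv eq)
  ... | 1F = proper₁ u v (layer⁺ G c 1F u v uv eq)
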